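{- Let $q$ be a prime power and let $L$ be a line of $\mathrm{PG}(5,q)$ in the $K$-orbit $o_5$. Then the hyperplane-orbit distribution of $L$ is $OD_4(L)=[1,\,2q^2+q,\,0,\,q^3-q^2]$.
   Context: A point $(y_0,\dots,y_5)$ of $\mathrm{PG}(5,q)$ is identified with the nonzero symmetric matrix $\begin{bmatrix} y_0&y_1&y_2\\ y_1&y_3&y_4\\ y_2&y_4&y_5\end{bmatrix}$ up to scalar. $K\cong\mathrm{PGL}(3,q)$ acts by $M\mapsto AMA^T$, $A\in\mathrm{GL}(3,q)$. The orbit $o_5$ is the $K$-orbit of the line $\left\{\begin{bmatrix}x&0&0\\0&y&0\\0&0&0\end{bmatrix}:(x,y)\in\mathrm{PG}(1,q)\right\}$. Hyperplanes correspond to conics of $\mathrm{PG}(2,q)$ (nonzero quadratic forms up to scalar): $\sum_{0\le i\le j\le2}a_{ij}X_iX_j$ corresponds to $a_{00}Y_0+a_{01}Y_1+a_{02}Y_2+a_{11}Y_3+a_{12}Y_4+a_{22}Y_5=0$. $\mathcal H_1,\mathcal H_{2,r},\mathcal H_{2,i},\mathcal H_3$ are the sets of hyperplanes corresponding respectively to double lines (scalar multiples of squares of linear forms), pairs of distinct real lines (products of two non-proportional linear forms over $\mathbb F_q$), pairs of conjugate imaginary lines (scalar multiples of products of two non-proportional linear forms conjugate over $\mathbb F_{q^2}$), and non-singular conics (those with $4a_{00}a_{11}a_{22}+a_{01}a_{02}a_{12}-a_{00}a_{12}^2-a_{11}a_{02}^2-a_{22}a_{01}^2\ne0$). $OD_4(L)=[h_1,h_{2,r},h_{2,i},h_3]$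 lists the numbers of hyperplanes in $\mathcal H_1,\mathcal H_{2,r},\mathcal H_{2,i},\mathcal H_3$ containing $L$. -}

module Defs where

open import Algebra.Bundles using (CommutativeRing; Semiring)
import Algebra.Definitions
import Algebra.Definitions.RawSemiring
open import Algebra.Morphism.Structures using (IsRingHomomorphism)
open import Data.Fin.Base using (Fin)
open import Data.Fin.Patterns using (0F; 1F; 2F; 3F; 4F; 5F)
open import Data.Fin.Properties using (_≟_)
open import Data.Nat.Base as ℕ using (ℕ; suc)
open import Data.Nat.Primality using (Prime)
open import Data.Product.Base using (Σ; Σ-syntax; ∃; ∃₂; ∃-syntax; _×_; _,_; proj₁)
open import Data.Vec.Base as Vec using (Vec)
open import Data.Vec.Functional using (Vector; []; _∷_; map; zipWith; replicate)
import Data.Vec.Functional.Relation.Binary.Equality.Setoid as VectorEquality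
open import Function.Base using (_on_)
open import Function.Bundles using (Inverse; _⇔_)
open import Level using (Level; _⊔_) renaming (suc to lsuc)
open import Relation.Binary.Bundles using (Setoid)
open import Relation.Binary.Core using (Rel)
open import Relation.Binary.PropositionalEquality.Core using (_≡_)
import Relation.Binary.PropositionalEquality.Properties as ≡
open import Relation.Nullary using (¬_; yes; no)
open import Relation.Unary using (Pred; _∈_)

IsPrimePower : ℕ → Set
IsPrimePower q = ∃₂ λ p k → Prime p × q ≡ p ℕ.^ suc k

HasCardinality : ∀ {a ℓ} → Setoid a ℓ → ℕ → Set (a ⊔ ℓ)
HasCardinality S n = Inverse S (≡.setoid (Fin n))

record FiniteField c ℓ (q : ℕ) : Set (lsuc (c ⊔ ℓ)) where
  field
    commutativeRing : CommutativeRing c ℓ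

  open CommutativeRing commutativeRing public
  open Algebra.Definitions _≈_ using (Invertible)

  field
    1≉0         : ¬ (1# ≈ 0#)
    invertible  : ∀ {x} → ¬ (x ≈ 0#) → Invertible 1# _*_ x
    cardinality : HasCardinality setoid q

  open Algebra.Definitions.RawSemiring (Semiring.rawSemiring semiring) public
    using (sum; _^_) renaming (_×_ to _·_)

record QuadraticExtension {c ℓ q} c′ ℓ′ (F : FiniteField c ℓ q)
                          : Set (c ⊔ ℓ ⊔ lsuc (c′ ⊔ ℓ′)) where
  private
    module F = FiniteField F

  field
    field² : FiniteField c′ ℓ′ (q ℕ.^ 2)

  open FiniteField field² public

  field
    embed              : F.Carrier → Carrier
    isRingHomomorphism : IsRingHomomorphism F.rawRing rawRing embed

  -- The non-trivial automorphism of 𝔽_{q²} over 𝔽_q.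
  conjugate : Carrier → Carrier
  conjugate x = x ^ q

module Projective {c ℓ q} (F : FiniteField c ℓ q) where

  open FiniteField F
  open VectorEquality setoid public using (_≋_)

  scale : ∀ {n} → Carrier → Vector Carrier n → Vector Carrier n
  scale c = map (c *_)

  infix 4 _∼_

  _∼_ : ∀ {n} → Rel (Vector Carrier n) (c ⊔ ℓ)
  u ∼ v = ∃[ c ] ¬ (c ≈ 0#) × u ≋ scale c v

  PG : ℕ → Set (c ⊔ ℓ)
  PG d = Σ[ v ∈ Vector Carrier (suc d) ] ¬ (v ≋ replicate (suc d) 0#)

  private
    ∼-refl : ∀ {n} {u : Vector Carrier n} → u ∼ u
    ∼-refl = 1# , 1≉0 , λ i → sym (*-identityˡ _)

    ∼-sym : ∀ {n} {u v : Vector Carrier n} → u ∼ v → v ∼ u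
    ∼-sym (c , c≉0 , u≋cv) with invertible c≉0
    ... | d , dc≈1 , cd≈1 =
      d
      , (λ d≈0 → 1≉0 (trans (sym dc≈1) (trans (*-congʳ d≈0) (zeroˡ c))))
      , λ i → trans (sym (*-identityˡ _))
              (trans (*-congʳ (sym dc≈1))
              (trans (*-assoc d c _) (*-congˡ (sym (u≋cv i)))))

    ∼-trans : ∀ {n} {u v w : Vector Carrier n} → u ∼ v → v ∼ w → u ∼ w
    ∼-trans (c , c≉0 , u≋cv) (d , d≉0 , v≋dw) with invertible c≉0
    ... | e , ec≈1 , _ =
      c * d
      , (λ cd≈0 → d≉0 (trans (sym (*-identityˡ d))
                       (trans (*-congʳ (sym ec≈1))
                       (trans (*-assoc e c d)
                       (trans (*-congˡ cd≈0) (zeroʳ e))))))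
      , λ i → trans (u≋cv i) (trans (*-congˡ (v≋dw i)) (sym (*-assoc c d _)))

  -- A set of points of PG(d,q) given by a predicate, counted up to
  -- proportionality of the representing vectors.
  subsetoid : ∀ {d p} → Pred (PG d) p → Setoid (c ⊔ ℓ ⊔ p) (c ⊔ ℓ)
  subsetoid P = record
    { Carrier       = Σ (PG _) P
    ; _≈_           = _∼_ on λ x → proj₁ (proj₁ x)
    ; isEquivalence = record { refl = ∼-refl ; sym = ∼-sym ; trans = ∼-trans }
    }

  record IsLine {d p} (L : Pred (PG d) p) : Set (c ⊔ ℓ ⊔ p) where
    field
      P Q      : PG d
      distinct : ¬ (proj₁ P ∼ proj₁ Q)
      span     : ∀ X → X ∈ L ⇔
                 (∃₂ λ s t → proj₁ X ≋
                    zipWith _+_ (scale s (proj₁ P)) (scale t (proj₁ Q)))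

module Matrices {c ℓ q} (F : FiniteField c ℓ q) where

  open FiniteField F
  open Projective F

  Matrix₃ : Set c
  Matrix₃ = Vector (Vector Carrier 3) 3

  infix 4 _≋ᴹ_ _∼ᴹ_
  infixl 7 _⊗_

  _≋ᴹ_ : Rel Matrix₃ ℓ
  M ≋ᴹ N = ∀ i → M i ≋ N i

  _∼ᴹ_ : Rel Matrix₃ (c ⊔ ℓ)
  M ∼ᴹ N = ∃[ c ] ¬ (c ≈ 0#) × M ≋ᴹ map (scale c) N

  _⊗_ : Matrix₃ → Matrix₃ → Matrix₃
  (M ⊗ N) i j = sum (λ k → M i k * N k j)

  _ᵀ : Matrix₃ → Matrix₃
  (M ᵀ) i j = M j i

  identity : Matrix₃
  identity i j with i ≟ j
  ... | yes _ = 1#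
  ... | no  _ = 0#

  open Algebra.Definitions _≋ᴹ_ using (Invertible)

  GL₃ : Set (c ⊔ ℓ)
  GL₃ = Σ Matrix₃ (Invertible identity _⊗_)

  symmetricMatrix : PG 5 → Matrix₃
  symmetricMatrix (y , _) =
    (y 0F ∷ y 1F ∷ y 2F ∷ []) ∷
    (y 1F ∷ y 3F ∷ y 4F ∷ []) ∷
    (y 2F ∷ y 4F ∷ y 5F ∷ []) ∷ []

  -- L is the image of L′ under some element of K ≅ PGL(3,q).
  _∈K-orbitOf_ : ∀ {p p′} → Pred (PG 5) p → Pred (PG 5) p′ → Set (c ⊔ ℓ ⊔ p ⊔ p′)
  L ∈K-orbitOf L′ =
    Σ[ (A , _) ∈ GL₃ ] ∀ X → X ∈ L ⇔
      (∃[ Y ] Y ∈ L′ × symmetricMatrix X ∼ᴹ A ⊗ symmetricMatrix Y ⊗ A ᵀ)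

  o₅-representative : Pred (PG 5) (c ⊔ ℓ)
  o₅-representative X =
    Σ[ (v , _) ∈ PG 1 ] symmetricMatrix X ∼ᴹ
      ( (v 0F ∷ 0#   ∷ 0# ∷ []) ∷
        (0#   ∷ v 1F ∷ 0# ∷ []) ∷
        (0#   ∷ 0#   ∷ 0# ∷ []) ∷ [] )

  o₅ : ∀ {p} → Pred (Pred (PG 5) p) (c ⊔ ℓ ⊔ p)
  o₅ L = L ∈K-orbitOf o₅-representative

-- A linear form is given by its coefficients at X₀, X₁, X₂ and a quadratic
-- form by its coefficients a₀₀, a₀₁, a₀₂, a₁₁, a₁₂, a₂₂, in this order.
module Forms {c ℓ q} (F : FiniteField c ℓ q) where

  open FiniteField F

  LinearForm QuadraticForm : Set c
  LinearForm    = Vector Carrier 3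
  QuadraticForm = Vector Carrier 6

  product : LinearForm → LinearForm → QuadraticForm
  product l m =
    l 0F * m 0F ∷
    l 0F * m 1F + l 1F * m 0F ∷
    l 0F * m 2F + l 2F * m 0F ∷
    l 1F * m 1F ∷
    l 1F * m 2F + l 2F * m 1F ∷
    l 2F * m 2F ∷ []

  discriminant : QuadraticForm → Carrier
  discriminant a =
    4 · (a₀₀ * a₁₁ * a₂₂) + a₀₁ * a₀₂ * a₁₂
      - a₀₀ * (a₁₂ ^ 2) - a₁₁ * (a₀₂ ^ 2) - a₂₂ * (a₀₁ ^ 2)
    where
    a₀₀ = a 0F
    a₀₁ = a 1F
    a₀₂ = a 2F
    a₁₁ = a 3F
    a₁₂ = a 4F
    a₂₂ = a 5F

module Hyperplanes {c ℓ c′ ℓ′ q} (F : FiniteField c ℓ q)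
                   (E : QuadraticExtension c′ ℓ′ F) where

  open FiniteField F
  open Projective F
  open Forms F
  private
    module E  = QuadraticExtension E
    module PE = Projective E.field²
    module FE = Forms E.field²

  -- A hyperplane of PG(5,q) is represented by the coefficients of its
  -- equation, which are also those of the corresponding conic.
  Hyperplane : Set (c ⊔ ℓ)
  Hyperplane = PG 5

  _liesOn_ : PG 5 → Hyperplane → Set ℓ
  (y , _) liesOn (a , _) = sum (zipWith _*_ a y) ≈ 0#

  Contains : ∀ {p} → Hyperplane → Pred (PG 5) p → Set (c ⊔ ℓ ⊔ p)
  Contains H L = ∀ X → X ∈ L → X liesOn H

  -- A hyperplane has non-zero coefficients, so the scalars and linear forms
  -- below are automatically non-zero; hence ∼ is proportionality of the two
  -- linear factors.
  ℋ₁ : Pred Hyperplane (c ⊔ ℓ)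
  ℋ₁ (a , _) = ∃₂ λ k l → a ≋ scale k (product l l)

  ℋ₂ᵣ : Pred Hyperplane (c ⊔ ℓ)
  ℋ₂ᵣ (a , _) = ∃₂ λ l m → ¬ (l ∼ m) × a ≋ product l m

  ℋ₂ᵢ : Pred Hyperplane (c ⊔ c′ ⊔ ℓ′)
  ℋ₂ᵢ (a , _) = ∃₂ λ (k : Carrier) (l : FE.LinearForm) →
    ¬ (l PE.∼ map E.conjugate l) ×
    map E.embed a PE.≋ PE.scale (E.embed k) (FE.product l (map E.conjugate l))

  ℋ₃ : Pred Hyperplane ℓ
  ℋ₃ (a , _) = ¬ (discriminant a ≈ 0#)

  NumberContaining : ∀ {p r} → Pred (PG 5) p → Pred Hyperplane r → ℕ →
                     Set (c ⊔ ℓ ⊔ p ⊔ r)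
  NumberContaining L ℋ n =
    HasCardinality (subsetoid λ H → H ∈ ℋ × Contains H L) n

  -- OD₄ L hs says that hs is the hyperplane-orbit distribution of L.
  OD₄ : ∀ {p} → Pred (PG 5) p → Vec ℕ 4 → Set (c ⊔ ℓ ⊔ c′ ⊔ ℓ′ ⊔ p)
  OD₄ L (h₁ Vec.∷ h₂ᵣ Vec.∷ h₂ᵢ Vec.∷ h₃ Vec.∷ Vec.[]) =
    NumberContaining L ℋ₁  h₁  ×
    NumberContaining L ℋ₂ᵣ h₂ᵣ ×
    NumberContaining L ℋ₂ᵢ h₂ᵢ ×
    NumberContaining L ℋ₃  h₃

module Submission where

-- With u = A e₀ and v = A e₁, the line L is spanned by the points uuᵀ and vvᵀ, and a
-- hyperplane contains L exactly when its conic f passes through u and v, that is, when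
-- f ∘ A = b X₀X₁ + c X₀X₂ + d X₁X₂ + e X₂².  Substituting an invertible matrix preserves
-- the type of a conic, and the discriminant of f ∘ A is b(cd − eb).  It vanishes for the
-- double line X₂² and for the line pairs (X₀ + dX₂)(X₁ + cX₂) and X₂(cX₀ + dX₁ + eX₂),
-- (c , d) ≠ 0, numbering q² and q² + q; the q²(q − 1) forms with b = 1 and e ≠ cd are
-- non-singular.  A conic l l̄ through rational points u and v has l(u) = l(v) = 0, because
-- l̄(u) is the conjugate of l(u); so l is a multiple of a rational form and l̄ ∼ l.

open import Algebra.Bundles using (CommutativeMonoid; CommutativeRing; RawRing)
import Algebra.Definitions.RawSemiring
open import Algebra.Morphism.Structures using (IsRingHomomorphism)
import Algebra.Properties.CommutativeMonoid.Sum as CommutativeMonoidSum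
import Algebra.Properties.CommutativeSemiring.Binomial as Binomial
import Algebra.Properties.Group as GroupProperties
import Algebra.Solver.Ring
open import Algebra.Solver.Ring.AlmostCommutativeRing
  using (fromCommutativeRing; _-Raw-AlmostCommutative⟶_)
open import Data.Fin.Base as Fin
  using (Fin; _↑ˡ_; _↑ʳ_; combine; fromℕ; inject₁; punchIn; punchOut)
open import Data.Fin.Patterns using (0F; 1F; 2F; 3F; 4F; 5F)
open import Data.Fin.Permutation using (Permutation; permutation)
import Data.Fin.Properties as Fin
open import Data.Integer.Base as ℤ using (ℤ; +_; -[1+_]; _⊖_)
import Data.Integer.Properties as ℤ
import Data.Maybe.Base as Maybe
open import Data.Nat.Base as ℕ using (ℕ; zero; suc; _!)
open import Data.Nat.Combinatorics using (_C_; nCn≡1; nCk≡n!/k![n-k]!; k![n∸k]!∣n!)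
open import Data.Nat.Divisibility using (_∣_; divides; ∣1⇒≡1; ∣⇒≤; m∣m*n)
open import Data.Nat.DivMod using (m/n*n≡m)
open import Data.Nat.Primality using (Prime; euclidsLemma; ¬prime[0]; ¬prime[1])
import Data.Nat.Properties as ℕ
open import Data.Nat.Solver using (module +-*-Solver)
open import Data.Product.Base using (∃; ∃₂; _×_; _,_; proj₁; proj₂)
open import Data.Product.Function.NonDependent.Propositional using (_×-↔_)
open import Data.Sum.Base using (_⊎_; inj₁; inj₂; [_,_]′)
open import Data.Sum.Function.Propositional using (_⊎-↔_)
open import Data.Vec.Base as Vec using (Vec; _++_)
open import Data.Vec.Functional using (Vector; map; zipWith)
import Data.Vec.Functional.Relation.Binary.Equality.Setoid as VectorEquality
open import Function.Base using (_∘_; id)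
open import Function.Bundles using (Inverse; Equivalence; _↔_)
open import Function.Construct.Composition using (_↔-∘_)
open import Function.Construct.Identity using (↔-id)
open import Function.Construct.Symmetry using (↔-sym)
open import Relation.Binary.Bundles using (Setoid)
open import Relation.Binary.Definitions using (Decidable)
open import Relation.Binary.PropositionalEquality.Core as ≡ using (_≡_)
import Relation.Binary.Reasoning.Setoid as ≈-Reasoning
open import Relation.Nullary using (¬_; yes; no; contradiction)
open import Relation.Nullary.Decidable using (map′; dec⇒maybe)

open import Defs
open import Level using (Level)
open import Relation.Unary using (Pred; _∈_)

-- Characteristic 2 is included, so a conic cannot be replaced by a symmetric bilinear form. The
-- coefficients of `f ∘ A` are instead values of f and of its undivided polar form at columns of
-- `A`, and the behaviour of the discriminant is an identity between integer polynomials. The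
-- coefficients of X₀² and X₁² in `f ∘ A` are f(u) and f(v), which is why exactly these two
-- disappear. Scaling the first nonzero coefficient among b, c, d to 1 selects one form in each
-- proportionality class. If b is nonzero and the discriminant vanishes, then e = cd/b is forced; if
-- b = 0, then X₂ divides the form, and the two factors are proportional only for multiples of X₂².
-- A field is given here only by its axioms and a bijection with `Fin q`. What conjugation needs is
-- therefore derived: it fixes the small field by Fermat's theorem, and it is additive by the
-- binomial theorem once the characteristic has been read off from the cardinality.

Matrix₃ : ∀ {c} → Set c → Set c
Matrix₃ A = Vector (Vector A 3) 3

-- The homomorphism from the integers to a commutative ring.

module IntegerMultiples {c ℓ} (R : CommutativeRing c ℓ) where

  open CommutativeRing R
  open import Algebra.Properties.Ring ring using (-‿distribˡ-*; -‿distribʳ-*)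
  open import Algebra.Properties.AbelianGroup +-abelianGroup
    using (ε⁻¹≈ε; ⁻¹-involutive; ⁻¹-∙-comm)
  open import Algebra.Properties.Semiring.Mult.TCOptimised semiring
    using (1+×; ×-homo-+; ×1-homo-*) renaming (_×_ to _·_)
  open ≈-Reasoning setoid

  -- With the optimised multiple, `int (+ 1)` computes to `1#` and not to a sum with `0#`, so
  -- constants of solved polynomials are literally the constants of the ring.
  int : ℤ → Carrier
  int (+ n)    = n · 1#
  int -[1+ n ] = - (suc n · 1#)

  int-⊖ : ∀ m n → int (m ⊖ n) ≈ m · 1# - n · 1#
  int-⊖ zero    zero    = sym (-‿inverseʳ 0#)
  int-⊖ zero    (suc n) = sym (+-identityˡ _)
  int-⊖ (suc m) zero    = sym (trans (+-congˡ ε⁻¹≈ε) (+-identityʳ _))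
  int-⊖ (suc m) (suc n) = begin
    int (suc m ⊖ suc n)                  ≡⟨ ≡.cong int (ℤ.[1+m]⊖[1+n]≡m⊖n m n) ⟩
    int (m ⊖ n)                          ≈⟨ int-⊖ m n ⟩
    m · 1# - n · 1#                      ≈⟨ +-congʳ (+-identityˡ _) ⟨
    (0# + m · 1#) - n · 1#               ≈⟨ +-congʳ (+-congʳ (-‿inverseʳ 1#)) ⟨
    (1# - 1# + m · 1#) - n · 1#
      ≈⟨ +-congʳ (trans (+-assoc _ _ _) (trans (+-congˡ (+-comm _ _)) (sym (+-assoc _ _ _)))) ⟩
    (1# + m · 1# - 1#) - n · 1#          ≈⟨ +-assoc _ _ _ ⟩
    1# + m · 1# + (- 1# - n · 1#)
      ≈⟨ +-cong (sym (1+× m 1#)) (trans (⁻¹-∙-comm _ _) (-‿cong (sym (1+× n 1#)))) ⟩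
    suc m · 1# - suc n · 1#              ∎

  int-neg : ∀ i → int (ℤ.- i) ≈ - int i
  int-neg (+ zero)  = sym ε⁻¹≈ε
  int-neg (+ suc n) = refl
  int-neg -[1+ n ]  = sym (⁻¹-involutive _)

  int-+ : ∀ i j → int (i ℤ.+ j) ≈ int i + int j
  int-+ (+ m)    (+ n)    = ×-homo-+ 1# m n
  int-+ (+ m)    -[1+ n ] = int-⊖ m (suc n)
  int-+ -[1+ m ] (+ n)    = trans (int-⊖ n (suc m)) (+-comm _ _)
  int-+ -[1+ m ] -[1+ n ] = begin
    - (suc (suc (m ℕ.+ n)) · 1#)       ≡⟨ ≡.cong (λ k → - (suc k · 1#)) (ℕ.+-suc m n) ⟨
    - ((suc m ℕ.+ suc n) · 1#)         ≈⟨ -‿cong (×-homo-+ 1# (suc m) (suc n)) ⟩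
    - (suc m · 1# + suc n · 1#)        ≈⟨ ⁻¹-∙-comm _ _ ⟨
    - (suc m · 1#) - suc n · 1#        ∎

  int-+* : ∀ m j → int (+ m ℤ.* j) ≈ int (+ m) * int j
  int-+* m (+ n) = begin
    int (+ m ℤ.* + n)   ≡⟨ ≡.cong int (ℤ.pos-* m n) ⟨
    (m ℕ.* n) · 1#      ≈⟨ ×1-homo-* m n ⟩
    (m · 1#) * (n · 1#) ∎
  int-+* m -[1+ n ] = begin
    int (+ m ℤ.* -[1+ n ])       ≡⟨ ≡.cong int (ℤ.neg-distribʳ-* (+ m) (+ suc n)) ⟨
    int (ℤ.- (+ m ℤ.* + suc n))  ≈⟨ int-neg (+ m ℤ.* + suc n) ⟩
    - int (+ m ℤ.* + suc n)      ≈⟨ -‿cong (int-+* m (+ suc n)) ⟩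
    - ((m · 1#) * (suc n · 1#))  ≈⟨ -‿distribʳ-* _ _ ⟩
    (m · 1#) * - (suc n · 1#)    ∎

  int-* : ∀ i j → int (i ℤ.* j) ≈ int i * int j
  int-* (+ m)    j = int-+* m j
  int-* -[1+ m ] j = begin
    int (-[1+ m ] ℤ.* j)         ≡⟨ ≡.cong int (ℤ.neg-distribˡ-* (+ suc m) j) ⟨
    int (ℤ.- (+ suc m ℤ.* j))    ≈⟨ int-neg (+ suc m ℤ.* j) ⟩
    - int (+ suc m ℤ.* j)        ≈⟨ -‿cong (int-+* (suc m) j) ⟩
    - ((suc m · 1#) * int j)     ≈⟨ -‿distribˡ-* _ _ ⟩
    - (suc m · 1#) * int j       ∎

-- Linear and quadratic forms in three variables.

module TernaryForms {a ℓ} (R : RawRing a ℓ) where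

  open import Data.Vec.Functional using (_∷_; [])
  open RawRing R
  open Algebra.Definitions.RawSemiring rawSemiring using (sum; _^_) renaming (_×_ to _·_)

  infixl 7 _⊗_

  scale : ∀ {n} → Carrier → Vector Carrier n → Vector Carrier n
  scale c = map (c *_)

  _⊗_ : Matrix₃ Carrier → Matrix₃ Carrier → Matrix₃ Carrier
  (M ⊗ N) i j = sum (λ k → M i k * N k j)

  transpose : Matrix₃ Carrier → Matrix₃ Carrier
  transpose M i j = M j i

  identity : Matrix₃ Carrier
  identity i j with i Fin.≟ j
  ... | yes _ = 1#
  ... | no  _ = 0#

  diagonal : Carrier → Carrier → Matrix₃ Carrier
  diagonal s t = (s ∷ 0# ∷ 0# ∷ []) ∷ (0# ∷ t ∷ 0# ∷ []) ∷ (0# ∷ 0# ∷ 0# ∷ []) ∷ []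

  symmetric : Vector Carrier 6 → Matrix₃ Carrier
  symmetric y =
    (y 0F ∷ y 1F ∷ y 2F ∷ []) ∷ (y 1F ∷ y 3F ∷ y 4F ∷ []) ∷ (y 2F ∷ y 4F ∷ y 5F ∷ []) ∷ []

  upper : Matrix₃ Carrier → Vector Carrier 6
  upper M 0F = M 0F 0F
  upper M 1F = M 0F 1F
  upper M 2F = M 0F 2F
  upper M 3F = M 1F 1F
  upper M 4F = M 1F 2F
  upper M 5F = M 2F 2F

  -- The point of the Veronese surface with rank-one matrix x xᵀ; pairing it with a hyperplane
  -- evaluates the corresponding conic at x.
  veronese : Vector Carrier 3 → Vector Carrier 6
  veronese x = upper λ i j → x i * x j

  determinant : Matrix₃ Carrier → Carrier
  determinant M =
    M 0F 0F * (M 1F 1F * M 2F 2F + - (M 1F 2F * M 2F 1F)) +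
    M 0F 1F * (M 1F 2F * M 2F 0F + - (M 1F 0F * M 2F 2F)) +
    M 0F 2F * (M 1F 0F * M 2F 1F + - (M 1F 1F * M 2F 0F))

  eval : Vector Carrier 3 → Vector Carrier 3 → Carrier
  eval l x = l 0F * x 0F + l 1F * x 1F + l 2F * x 2F

  product : Vector Carrier 3 → Vector Carrier 3 → Vector Carrier 6
  product l m =
    l 0F * m 0F ∷ l 0F * m 1F + l 1F * m 0F ∷ l 0F * m 2F + l 2F * m 0F ∷
    l 1F * m 1F ∷ l 1F * m 2F + l 2F * m 1F ∷ l 2F * m 2F ∷ []

  discriminant : Vector Carrier 6 → Carrier
  discriminant a =
    4 · (a 0F * a 3F * a 5F) + a 1F * a 2F * a 4F
      + - (a 0F * (a 4F ^ 2)) + - (a 3F * (a 2F ^ 2)) + - (a 5F * (a 1F ^ 2))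

  incidence : Vector Carrier 6 → Vector Carrier 6 → Carrier
  incidence a y = sum (zipWith _*_ a y)

  value : Vector Carrier 6 → Vector Carrier 3 → Carrier
  value a x = incidence a (veronese x)

  -- f(x + y) − f(x) − f(y), hence the doubled diagonal terms.
  polar : Vector Carrier 6 → Vector Carrier 3 → Vector Carrier 3 → Carrier
  polar a x y = incidence a (upper λ i j → x i * y j + x j * y i)

  column : Matrix₃ Carrier → Fin 3 → Vector Carrier 3
  column M j i = M i j

  -- By cases on the index, so that terms at a variable index stay folded.
  substituteLinear : Matrix₃ Carrier → Vector Carrier 3 → Vector Carrier 3
  substituteLinear M l 0F = eval l (column M 0F)
  substituteLinear M l 1F = eval l (column M 1F)
  substituteLinear M l 2F = eval l (column M 2F)

  -- The quadratic form X ↦ f(MX): since MX is the combination of the columns with coefficients Xᵢ,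
  -- squares get values of f and mixed terms get the polar form.
  substitute : Matrix₃ Carrier → Vector Carrier 6 → Vector Carrier 6
  substitute M a 0F = value a (column M 0F)
  substitute M a 1F = polar a (column M 0F) (column M 1F)
  substitute M a 2F = polar a (column M 0F) (column M 2F)
  substitute M a 3F = value a (column M 1F)
  substitute M a 4F = polar a (column M 1F) (column M 2F)
  substitute M a 5F = value a (column M 2F)

-- Polynomial identities.

module Identities {c ℓ} (R : CommutativeRing c ℓ) where

  open import Data.Vec.Functional using (_∷_; [])
  open CommutativeRing R
  open IntegerMultiples R

  private
    -- Integer coefficients are compared by computation, whereas equality in `R` is not assumed
    -- decidable.
    integerMorphism : ℤ.+-*-rawRing -Raw-AlmostCommutative⟶ fromCommutativeRing R
    integerMorphism = record
      { ⟦_⟧ = int ; +-homo = int-+ ; *-homo = int-* ; -‿homo = int-neg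
      ; 0-homo = refl ; 1-homo = refl }

  open Algebra.Solver.Ring ℤ.+-*-rawRing (fromCommutativeRing R) integerMorphism
    (λ i j → Maybe.map (reflexive ∘ ≡.cong int) (dec⇒maybe (i ℤ.≟ j)))
    public using (Polynomial; con; var; _:+_; _:*_; :-_; _:-_; prove; solve; _:=_)

  -- Instantiating TernaryForms at syntactic polynomials as well lets the solver be
  -- applied to its definitions without restating them.
  polynomials : ℕ → RawRing _ _
  polynomials n = record
    { Carrier = Polynomial n ; _≈_ = _≡_ ; _+_ = _:+_ ; _*_ = _:*_ ; -_ = :-_
    ; 0# = con (+ 0) ; 1# = con (+ 1) }

  open TernaryForms rawRing
  open Algebra.Definitions.RawSemiring (RawRing.rawSemiring rawRing) using () renaming (_×_ to _·_)
  open VectorEquality setoid using (_≋_)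
  private module S {n} = TernaryForms (polynomials n)

  private
    -- Row by row, the order of `combine`: entry (i, j) becomes variable `combine i j` of its block,
    -- and the injections `↑ˡ` and `↑ʳ` below select the block of the environment.
    flatten : Matrix₃ Carrier → Vec Carrier 9
    flatten M = Vec.concat (Vec.tabulate λ i → Vec.tabulate (M i))

  module _ (M N : Matrix₃ Carrier) (a : Vector Carrier 6) where

    private
      ρ  = flatten M ++ flatten N ++ Vec.tabulate a
      M′ N′ : Matrix₃ (Polynomial 24)
      M′ i j = var (combine i j ↑ˡ 15)
      N′ i j = var (9 ↑ʳ (combine i j ↑ˡ 6))
      a′ : Vector (Polynomial 24) 6
      a′ i = var (18 ↑ʳ i)
      lhs = S.substitute N′ (S.substitute M′ a′)
      rhs = S.substitute (M′ S.⊗ N′) a′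

    substitute-⊗ : substitute N (substitute M a) ≋ substitute (M ⊗ N) a
    substitute-⊗ 0F = prove ρ (lhs 0F) (rhs 0F) refl
    substitute-⊗ 1F = prove ρ (lhs 1F) (rhs 1F) refl
    substitute-⊗ 2F = prove ρ (lhs 2F) (rhs 2F) refl
    substitute-⊗ 3F = prove ρ (lhs 3F) (rhs 3F) refl
    substitute-⊗ 4F = prove ρ (lhs 4F) (rhs 4F) refl
    substitute-⊗ 5F = prove ρ (lhs 5F) (rhs 5F) refl

  module _ (a : Vector Carrier 6) where

    private
      ρ = Vec.tabulate a
      lhs = S.substitute S.identity var

    substitute-identity : substitute identity a ≋ a
    substitute-identity 0F = prove ρ (lhs 0F) (var 0F) refl
    substitute-identity 1F = prove ρ (lhs 1F) (var 1F) refl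
    substitute-identity 2F = prove ρ (lhs 2F) (var 2F) refl
    substitute-identity 3F = prove ρ (lhs 3F) (var 3F) refl
    substitute-identity 4F = prove ρ (lhs 4F) (var 4F) refl
    substitute-identity 5F = prove ρ (lhs 5F) (var 5F) refl

  module _ (k : Carrier) (M : Matrix₃ Carrier) (a : Vector Carrier 6) where

    private
      ρ = flatten M ++ Vec.tabulate a ++ Vec.[ k ]
      M′ : Matrix₃ (Polynomial 16)
      M′ i j = var (combine i j ↑ˡ 7)
      a′ : Vector (Polynomial 16) 6
      a′ i = var (9 ↑ʳ (i ↑ˡ 1))
      k′ : Polynomial 16
      k′ = var (15 ↑ʳ 0F)
      lhs = S.substitute M′ (S.scale k′ a′)
      rhs = S.scale k′ (S.substitute M′ a′)

    substitute-scale : substitute M (scale k a) ≋ scale k (substitute M a)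
    substitute-scale 0F = prove ρ (lhs 0F) (rhs 0F) refl
    substitute-scale 1F = prove ρ (lhs 1F) (rhs 1F) refl
    substitute-scale 2F = prove ρ (lhs 2F) (rhs 2F) refl
    substitute-scale 3F = prove ρ (lhs 3F) (rhs 3F) refl
    substitute-scale 4F = prove ρ (lhs 4F) (rhs 4F) refl
    substitute-scale 5F = prove ρ (lhs 5F) (rhs 5F) refl

  module _ (M : Matrix₃ Carrier) (l m : Vector Carrier 3) where

    private
      ρ = flatten M ++ Vec.tabulate l ++ Vec.tabulate m
      M′ : Matrix₃ (Polynomial 15)
      M′ i j = var (combine i j ↑ˡ 6)
      l′ m′ : Vector (Polynomial 15) 3
      l′ i = var (9 ↑ʳ (i ↑ˡ 3))
      m′ i = var (12 ↑ʳ i)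
      lhs = S.substitute M′ (S.product l′ m′)
      rhs = S.product (S.substituteLinear M′ l′) (S.substituteLinear M′ m′)

    substitute-product :
      substitute M (product l m) ≋ product (substituteLinear M l) (substituteLinear M m)
    substitute-product 0F = prove ρ (lhs 0F) (rhs 0F) refl
    substitute-product 1F = prove ρ (lhs 1F) (rhs 1F) refl
    substitute-product 2F = prove ρ (lhs 2F) (rhs 2F) refl
    substitute-product 3F = prove ρ (lhs 3F) (rhs 3F) refl
    substitute-product 4F = prove ρ (lhs 4F) (rhs 4F) refl
    substitute-product 5F = prove ρ (lhs 5F) (rhs 5F) refl

  module _ (M N : Matrix₃ Carrier) (l : Vector Carrier 3) where

    private
      ρ = flatten M ++ flatten N ++ Vec.tabulate l
      M′ N′ : Matrix₃ (Polynomial 21)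
      M′ i j = var (combine i j ↑ˡ 12)
      N′ i j = var (9 ↑ʳ (combine i j ↑ˡ 3))
      l′ : Vector (Polynomial 21) 3
      l′ i = var (18 ↑ʳ i)
      lhs = S.substituteLinear N′ (S.substituteLinear M′ l′)
      rhs = S.substituteLinear (M′ S.⊗ N′) l′

    substituteLinear-⊗ :
      substituteLinear N (substituteLinear M l) ≋ substituteLinear (M ⊗ N) l
    substituteLinear-⊗ 0F = prove ρ (lhs 0F) (rhs 0F) refl
    substituteLinear-⊗ 1F = prove ρ (lhs 1F) (rhs 1F) refl
    substituteLinear-⊗ 2F = prove ρ (lhs 2F) (rhs 2F) refl

  module _ (l : Vector Carrier 3) where

    private
      ρ = Vec.tabulate l
      lhs = S.substituteLinear S.identity var

    substituteLinear-identity : substituteLinear identity l ≋ l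
    substituteLinear-identity 0F = prove ρ (lhs 0F) (var 0F) refl
    substituteLinear-identity 1F = prove ρ (lhs 1F) (var 1F) refl
    substituteLinear-identity 2F = prove ρ (lhs 2F) (var 2F) refl

  module _ (k : Carrier) (M : Matrix₃ Carrier) (l : Vector Carrier 3) where

    private
      ρ = flatten M ++ Vec.tabulate l ++ Vec.[ k ]
      M′ : Matrix₃ (Polynomial 13)
      M′ i j = var (combine i j ↑ˡ 4)
      l′ : Vector (Polynomial 13) 3
      l′ i = var (9 ↑ʳ (i ↑ˡ 1))
      k′ : Polynomial 13
      k′ = var (12 ↑ʳ 0F)
      lhs = S.substituteLinear M′ (S.scale k′ l′)
      rhs = S.scale k′ (S.substituteLinear M′ l′)

    substituteLinear-scale : substituteLinear M (scale k l) ≋ scale k (substituteLinear M l)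
    substituteLinear-scale 0F = prove ρ (lhs 0F) (rhs 0F) refl
    substituteLinear-scale 1F = prove ρ (lhs 1F) (rhs 1F) refl
    substituteLinear-scale 2F = prove ρ (lhs 2F) (rhs 2F) refl

  -- Twice the discriminant is the determinant of the matrix G with diagonal 2aᵢᵢ and off-diagonal
  -- aᵢⱼ, and substitution turns G into MᵀGM. Halving is legitimate between integer polynomials, so
  -- the identity survives in characteristic 2.
  discriminant-substitute : ∀ M a →
    discriminant (substitute M a) ≈ determinant M * determinant M * discriminant a
  discriminant-substitute M a =
    prove (flatten M ++ Vec.tabulate a)
      (S.discriminant (S.substitute M′ a′))
      (S.determinant M′ :* S.determinant M′ :* S.discriminant a′) refl
    where
    M′ : Matrix₃ (Polynomial 15)
    M′ i j = var (combine i j ↑ˡ 6)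
    a′ : Vector (Polynomial 15) 6
    a′ i = var (9 ↑ʳ i)

  -- The matrix G of a product is l mᵀ + m lᵀ, of rank at most 2.
  discriminant-product : ∀ l m → discriminant (product l m) ≈ 0#
  discriminant-product l m =
    prove (Vec.tabulate l ++ Vec.tabulate m)
      (S.discriminant (S.product (λ i → var (i ↑ˡ 3)) (λ i → var (3 ↑ʳ i)))) (con (+ 0)) refl

  -- Isolates the terms divisible by the coefficients of X₀² or X₁², which vanish for a conic
  -- through the first two base points.
  discriminant-expand : ∀ a → discriminant a ≈
    a 1F * (a 2F * a 4F - a 5F * a 1F) +
    (a 0F * (4 · (a 3F * a 5F) - a 4F * a 4F) - a 3F * (a 2F * a 2F))
  discriminant-expand a =
    prove (Vec.tabulate a) (S.discriminant var)
      (x 1F :* (x 2F :* x 4F :- x 5F :* x 1F) :+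
       (x 0F :* (4 ·′ (x 3F :* x 5F) :- x 4F :* x 4F) :- x 3F :* (x 2F :* x 2F))) refl
    where
    x : Vector (Polynomial 6) 6
    x = var
    open Algebra.Definitions.RawSemiring (RawRing.rawSemiring (polynomials 6)) renaming (_×_ to _·′_)

  -- A diag(s, t, 0) Aᵀ = s uuᵀ + t vvᵀ for the first two columns u, v of `A`. The scalars `c` and
  -- `d` come from the two matrix equalities up to proportionality, in the orbit and in its
  -- representative.
  incidence-orbit : ∀ c d s t A a →
    incidence a (upper (map (scale c) (A ⊗ map (scale d) (diagonal s t) ⊗ transpose A))) ≈
    c * d * (s * substitute A a 0F + t * substitute A a 3F)
  incidence-orbit c d s t A a =
    prove (flatten A ++ Vec.tabulate a ++ c Vec.∷ d Vec.∷ s Vec.∷ t Vec.∷ Vec.[])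
      (S.incidence a′
        (S.upper (map (S.scale c′) (A′ S.⊗ map (S.scale d′) (S.diagonal s′ t′) S.⊗ S.transpose A′))))
      (c′ :* d′ :* (s′ :* S.substitute A′ a′ 0F :+ t′ :* S.substitute A′ a′ 3F)) refl
    where
    A′ : Matrix₃ (Polynomial 19)
    A′ i j = var (combine i j ↑ˡ 10)
    a′ : Vector (Polynomial 19) 6
    a′ i = var (9 ↑ʳ (i ↑ˡ 4))
    c′ d′ s′ t′ : Polynomial 19
    c′ = var (15 ↑ʳ 0F)
    d′ = var (15 ↑ʳ 1F)
    s′ = var (15 ↑ʳ 2F)
    t′ = var (15 ↑ʳ 3F)

  discriminant-normalForm : ∀ c d e →
    discriminant (0# ∷ 1# ∷ c ∷ 0# ∷ d ∷ c * d - e ∷ []) ≈ e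
  discriminant-normalForm c d e =
    prove (c Vec.∷ d Vec.∷ e Vec.∷ Vec.[])
      (S.discriminant (con (+ 0) ∷ con (+ 1) ∷ var 0F ∷ con (+ 0) ∷ var 1F ∷
        var 0F :* var 1F :- var 2F ∷ []))
      (var 2F) refl

  value-product : ∀ k l m x → value (scale k (product l m)) x ≈ k * (eval l x * eval m x)
  value-product k l m x =
    prove (Vec.tabulate l ++ Vec.tabulate m ++ Vec.tabulate x ++ Vec.[ k ])
      (S.value (S.scale k′ (S.product l′ m′)) x′) (k′ :* (S.eval l′ x′ :* S.eval m′ x′)) refl
    where
    k′ : Polynomial 10
    k′ = var (9 ↑ʳ 0F)
    l′ m′ x′ : Vector (Polynomial 10) 3
    l′ i = var (i ↑ˡ 7)
    m′ i = var (3 ↑ʳ (i ↑ˡ 4))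
    x′ i = var (6 ↑ʳ (i ↑ˡ 1))

  symmetric-diagonal : ∀ s t i j → symmetric (upper (diagonal s t)) i j ≡ diagonal s t i j
  symmetric-diagonal s t 0F 0F = ≡.refl
  symmetric-diagonal s t 0F 1F = ≡.refl
  symmetric-diagonal s t 0F 2F = ≡.refl
  symmetric-diagonal s t 1F 0F = ≡.refl
  symmetric-diagonal s t 1F 1F = ≡.refl
  symmetric-diagonal s t 1F 2F = ≡.refl
  symmetric-diagonal s t 2F 0F = ≡.refl
  symmetric-diagonal s t 2F 1F = ≡.refl
  symmetric-diagonal s t 2F 2F = ≡.refl

  module _ (A : Matrix₃ Carrier) where

    private
      ρ = flatten A
      A′ : Matrix₃ (Polynomial 9)
      A′ i j = var (combine i j)
      lhs : Fin 3 → Matrix₃ (Polynomial 9)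
      lhs k = S.symmetric (S.veronese (S.column A′ k))
      rhs : Polynomial 9 → Polynomial 9 → Matrix₃ (Polynomial 9)
      rhs s t = map (S.scale (con (+ 1)))
        (A′ S.⊗ S.symmetric (S.upper (S.diagonal s t)) S.⊗ S.transpose A′)
      rhs₀ = rhs (con (+ 1)) (con (+ 0))
      rhs₁ = rhs (con (+ 0)) (con (+ 1))

    -- The representative's point diag(1, 0, 0) is carried to uuᵀ; `scale 1#` makes this the witness
    -- that `∼ᴹ` asks for.
    symmetric-column₀ : ∀ i → symmetric (veronese (column A 0F)) i ≋
      map (scale 1#) (A ⊗ symmetric (upper (diagonal 1# 0#)) ⊗ transpose A) i
    symmetric-column₀ 0F 0F = prove ρ (lhs 0F 0F 0F) (rhs₀ 0F 0F) refl
    symmetric-column₀ 0F 1F = prove ρ (lhs 0F 0F 1F) (rhs₀ 0F 1F) refl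
    symmetric-column₀ 0F 2F = prove ρ (lhs 0F 0F 2F) (rhs₀ 0F 2F) refl
    symmetric-column₀ 1F 0F = prove ρ (lhs 0F 1F 0F) (rhs₀ 1F 0F) refl
    symmetric-column₀ 1F 1F = prove ρ (lhs 0F 1F 1F) (rhs₀ 1F 1F) refl
    symmetric-column₀ 1F 2F = prove ρ (lhs 0F 1F 2F) (rhs₀ 1F 2F) refl
    symmetric-column₀ 2F 0F = prove ρ (lhs 0F 2F 0F) (rhs₀ 2F 0F) refl
    symmetric-column₀ 2F 1F = prove ρ (lhs 0F 2F 1F) (rhs₀ 2F 1F) refl
    symmetric-column₀ 2F 2F = prove ρ (lhs 0F 2F 2F) (rhs₀ 2F 2F) refl

    symmetric-column₁ : ∀ i → symmetric (veronese (column A 1F)) i ≋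
      map (scale 1#) (A ⊗ symmetric (upper (diagonal 0# 1#)) ⊗ transpose A) i
    symmetric-column₁ 0F 0F = prove ρ (lhs 1F 0F 0F) (rhs₁ 0F 0F) refl
    symmetric-column₁ 0F 1F = prove ρ (lhs 1F 0F 1F) (rhs₁ 0F 1F) refl
    symmetric-column₁ 0F 2F = prove ρ (lhs 1F 0F 2F) (rhs₁ 0F 2F) refl
    symmetric-column₁ 1F 0F = prove ρ (lhs 1F 1F 0F) (rhs₁ 1F 0F) refl
    symmetric-column₁ 1F 1F = prove ρ (lhs 1F 1F 1F) (rhs₁ 1F 1F) refl
    symmetric-column₁ 1F 2F = prove ρ (lhs 1F 1F 2F) (rhs₁ 1F 2F) refl
    symmetric-column₁ 2F 0F = prove ρ (lhs 1F 2F 0F) (rhs₁ 2F 0F) refl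
    symmetric-column₁ 2F 1F = prove ρ (lhs 1F 2F 1F) (rhs₁ 2F 1F) refl
    symmetric-column₁ 2F 2F = prove ρ (lhs 1F 2F 2F) (rhs₁ 2F 2F) refl

-- Compatibility with the equality of the ring.

module Congruences {c ℓ} (R : CommutativeRing c ℓ) where

  open CommutativeRing R
  open TernaryForms rawRing
  open VectorEquality setoid using (_≋_)
  open import Algebra.Properties.Monoid.Sum +-monoid using (sum-cong-≋)
  open import Algebra.Properties.Semiring.Mult semiring using (×-congʳ)
  open import Algebra.Properties.Semiring.Exp semiring using (^-congˡ)

  ⊗-cong : ∀ {M M′ N N′} → (∀ i → M i ≋ M′ i) → (∀ i → N i ≋ N′ i) →
    ∀ i → (M ⊗ N) i ≋ (M′ ⊗ N′) i
  ⊗-cong M≋M′ N≋N′ i j = sum-cong-≋ λ k → *-cong (M≋M′ i k) (N≋N′ k j)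

  upper-cong : ∀ {M N} → (∀ i → M i ≋ N i) → upper M ≋ upper N
  upper-cong M≋N 0F = M≋N 0F 0F
  upper-cong M≋N 1F = M≋N 0F 1F
  upper-cong M≋N 2F = M≋N 0F 2F
  upper-cong M≋N 3F = M≋N 1F 1F
  upper-cong M≋N 4F = M≋N 1F 2F
  upper-cong M≋N 5F = M≋N 2F 2F

  incidence-cong : ∀ {a a′ y y′} → a ≋ a′ → y ≋ y′ → incidence a y ≈ incidence a′ y′
  incidence-cong a≋a′ y≋y′ = sum-cong-≋ λ i → *-cong (a≋a′ i) (y≋y′ i)

  value-cong : ∀ {a a′ x x′} → a ≋ a′ → x ≋ x′ → value a x ≈ value a′ x′
  value-cong a≋a′ x≋x′ =
    incidence-cong a≋a′ (upper-cong λ i j → *-cong (x≋x′ i) (x≋x′ j))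

  polar-cong : ∀ {a a′ x x′ y y′} → a ≋ a′ → x ≋ x′ → y ≋ y′ → polar a x y ≈ polar a′ x′ y′
  polar-cong a≋a′ x≋x′ y≋y′ = incidence-cong a≋a′
    (upper-cong λ i j → +-cong (*-cong (x≋x′ i) (y≋y′ j)) (*-cong (x≋x′ j) (y≋y′ i)))

  substitute-cong : ∀ {M N a b} → (∀ i → M i ≋ N i) → a ≋ b → substitute M a ≋ substitute N b
  substitute-cong M≋N a≋b 0F = value-cong a≋b (λ i → M≋N i 0F)
  substitute-cong M≋N a≋b 1F = polar-cong a≋b (λ i → M≋N i 0F) (λ i → M≋N i 1F)
  substitute-cong M≋N a≋b 2F = polar-cong a≋b (λ i → M≋N i 0F) (λ i → M≋N i 2F)
  substitute-cong M≋N a≋b 3F = value-cong a≋b (λ i → M≋N i 1F)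
  substitute-cong M≋N a≋b 4F = polar-cong a≋b (λ i → M≋N i 1F) (λ i → M≋N i 2F)
  substitute-cong M≋N a≋b 5F = value-cong a≋b (λ i → M≋N i 2F)

  eval-cong : ∀ {l m x y} → l ≋ m → x ≋ y → eval l x ≈ eval m y
  eval-cong l≋m x≋y = +-cong (+-cong (*-cong (l≋m 0F) (x≋y 0F)) (*-cong (l≋m 1F) (x≋y 1F)))
    (*-cong (l≋m 2F) (x≋y 2F))

  substituteLinear-cong : ∀ {M N l m} → (∀ i → M i ≋ N i) → l ≋ m →
    substituteLinear M l ≋ substituteLinear N m
  substituteLinear-cong M≋N l≋m 0F = eval-cong l≋m (λ i → M≋N i 0F)
  substituteLinear-cong M≋N l≋m 1F = eval-cong l≋m (λ i → M≋N i 1F)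
  substituteLinear-cong M≋N l≋m 2F = eval-cong l≋m (λ i → M≋N i 2F)

  discriminant-cong : ∀ {a b} → a ≋ b → discriminant a ≈ discriminant b
  discriminant-cong a≋b =
    +-cong (+-cong (+-cong (+-cong
      (×-congʳ 4 (*-cong (*-cong (a≋b 0F) (a≋b 3F)) (a≋b 5F)))
      (*-cong (*-cong (a≋b 1F) (a≋b 2F)) (a≋b 4F)))
      (minus 0F 4F)) (minus 3F 2F)) (minus 5F 1F)
    where
    minus : ∀ i j → _
    minus i j = -‿cong (*-cong (a≋b i) (^-congˡ 2 (a≋b j)))

-- Substitution of an invertible matrix.

module InverseSubstitution {c ℓ} (R : CommutativeRing c ℓ) where

  open CommutativeRing R
  open TernaryForms rawRing
  open Identities R
  open Congruences R
  open VectorEquality setoid using (_≋_)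

  module _ {M N} (MN≋I : ∀ i → (M ⊗ N) i ≋ identity i) where

    substitute-inverse : ∀ a → substitute N (substitute M a) ≋ a
    substitute-inverse a i = trans (substitute-⊗ M N a i)
      (trans (substitute-cong {a = a} MN≋I (λ _ → refl) i) (substitute-identity a i))

    substituteLinear-inverse : ∀ l → substituteLinear N (substituteLinear M l) ≋ l
    substituteLinear-inverse l i = trans (substituteLinear-⊗ M N l i)
      (trans (substituteLinear-cong {l = l} MN≋I (λ _ → refl) i) (substituteLinear-identity l i))

    -- Substituting `N` back multiplies the discriminant by the square of det N, so no determinant
    -- has to be shown nonzero.
    discriminant-substitute⁻ : ∀ a → discriminant (substitute M a) ≈ 0# → discriminant a ≈ 0#
    discriminant-substitute⁻ a disc≈0 =
      trans (discriminant-cong (λ i → sym (substitute-inverse a i)))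
      (trans (discriminant-substitute N (substitute M a))
      (trans (*-congˡ disc≈0) (zeroʳ _)))

-- Translating an enumeration, for the additive and for the multiplicative structure.

module Translation {c ℓ} (M : CommutativeMonoid c ℓ) where

  open CommutativeMonoid M
  open CommutativeMonoidSum M
  open ≈-Reasoning setoid
  open import Algebra.Properties.Monoid.Mult monoid using () renaming (_×_ to _·_)

  -- Multiplication by an invertible element permutes the listed elements.
  sum-translate : ∀ {n} (e : Vector Carrier n) (_ : ∀ {i j} → e i ≈ e j → i ≡ j) {x y} →
    y ∙ x ≈ ε → (∀ i → ∃ λ j → e j ≈ x ∙ e i) → (∀ i → ∃ λ j → e j ≈ y ∙ e i) →
    sum e ≈ n · x ∙ sum e
  sum-translate {n} e e-injective {x} {y} yx≈ε σ τ = begin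
    sum e                                ≈⟨ sum-permute e π ⟩
    sum (λ i → e (proj₁ (σ i)))          ≈⟨ sum-cong-≋ (λ i → proj₂ (σ i)) ⟩
    sum (λ i → x ∙ e i)                  ≈⟨ ∑-distrib-+ (λ _ → x) e ⟩
    sum {n} (λ _ → x) ∙ sum e            ≈⟨ ∙-congʳ (sum-replicate n) ⟩
    n · x ∙ sum e                        ∎
    where
    cancel : ∀ {u v} → v ∙ u ≈ ε → ∀ {i j k} → e j ≈ u ∙ e i → e k ≈ v ∙ e j → k ≡ i
    cancel {u} {v} vu≈ε {i} {j} {k} ej ek = e-injective (begin
      e k             ≈⟨ ek ⟩
      v ∙ e j         ≈⟨ ∙-congˡ ej ⟩
      v ∙ (u ∙ e i)   ≈⟨ assoc _ _ _ ⟨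
      (v ∙ u) ∙ e i   ≈⟨ ∙-congʳ vu≈ε ⟩
      ε ∙ e i         ≈⟨ identityˡ _ ⟩
      e i             ∎)
    π : Permutation n n
    π = permutation (proj₁ ∘ σ) (proj₁ ∘ τ)
      (λ i → cancel (trans (comm x y) yx≈ε) (proj₂ (τ i)) (proj₂ (σ (proj₁ (τ i)))))
      (λ i → cancel yx≈ε (proj₂ (σ i)) (proj₂ (τ (proj₁ (σ i)))))

-- Binomial coefficients and the Frobenius map.

prime∤! : ∀ {p} → Prime p → ∀ k → k ℕ.< p → ¬ (p ∣ k !)
prime∤! {p} pr zero    k<p p∣1 = contradiction pr (≡.subst (¬_ ∘ Prime) (≡.sym (∣1⇒≡1 p∣1)) ¬prime[1])
prime∤! {p} pr (suc k) k<p p∣k! with euclidsLemma (suc k) (k !) pr p∣k!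
... | inj₁ p∣1+k = ℕ.<⇒≱ k<p (∣⇒≤ p∣1+k)
... | inj₂ p∣k!  = prime∤! pr k (ℕ.<⇒≤ k<p) p∣k!

-- p divides p! = (p C k) k! (p - k)!, but neither of the two factorials, whose arguments are both
-- below p.
prime∣binomial : ∀ {p k} → Prime p → 0 ℕ.< k → k ℕ.< p → p ∣ p C k
prime∣binomial {zero}      pr 0<k k<p = contradiction pr ¬prime[0]
prime∣binomial {p@(suc n)} {k} pr 0<k k<p
  with euclidsLemma (p C k) (k ! ℕ.* (p ℕ.∸ k) !) pr (≡.subst (p ∣_) (≡.sym product≡p!) (m∣m*n (n !)))
  where
  instance _ = ℕ.m*n≢0 (k !) ((p ℕ.∸ k) !) {{k ℕ.!≢0}} {{(p ℕ.∸ k) ℕ.!≢0}}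
  product≡p! : (p C k) ℕ.* (k ! ℕ.* (p ℕ.∸ k) !) ≡ p !
  product≡p! = ≡.trans
    (≡.cong (ℕ._* (k ! ℕ.* (p ℕ.∸ k) !)) (nCk≡n!/k![n-k]! (ℕ.<⇒≤ k<p)))
    (m/n*n≡m (k![n∸k]!∣n! (ℕ.<⇒≤ k<p)))
... | inj₁ p∣pCk = p∣pCk
... | inj₂ p∣k!j! with euclidsLemma (k !) ((p ℕ.∸ k) !) pr p∣k!j!
...   | inj₁ p∣k! = contradiction p∣k! (prime∤! pr k k<p)
...   | inj₂ p∣j! = contradiction p∣j! (prime∤! pr (p ℕ.∸ k) (ℕ.∸-monoʳ-< 0<k (ℕ.<⇒≤ k<p)))

module Characteristic {c ℓ} (R : CommutativeRing c ℓ) where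

  open CommutativeRing R
  open import Algebra.Properties.Semiring.Mult semiring renaming (_×_ to _·_)
  open import Algebra.Properties.Semiring.Exp semiring
  open ≈-Reasoning setoid
  open import Algebra.Properties.Monoid.Sum +-monoid

  multiple≈0 : ∀ {p} → p · 1# ≈ 0# → ∀ {n} → p ∣ n → ∀ x → n · x ≈ 0#
  multiple≈0 {p} p1≈0 (divides k ≡.refl) x = begin
    (k ℕ.* p) · x     ≈⟨ ×-assocˡ x k p ⟨
    k · (p · x)       ≈⟨ ×-congʳ k (×-congʳ p (*-identityˡ x)) ⟨
    k · (p · (1# * x)) ≈⟨ ×-congʳ k (×-assoc-* p 1# x) ⟨
    k · (p · 1# * x)  ≈⟨ ×-congʳ k (trans (*-congʳ p1≈0) (zeroˡ x)) ⟩
    k · 0#            ≈⟨ sum-replicate k ⟨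
    sum {k} (λ _ → 0#) ≈⟨ sum-replicate-zero k ⟩
    0#                ∎

  -- The inner binomial coefficients are multiples of p. The k-th term carries x to the power k, so
  -- the surviving first and last terms appear in reverse order.
  frobenius-prime : ∀ {p} → Prime p → p · 1# ≈ 0# → ∀ x y → (x + y) ^ p ≈ x ^ p + y ^ p
  frobenius-prime {0}             pr p1≈0 x y = contradiction pr ¬prime[0]
  frobenius-prime {p@(suc n)}     pr p1≈0 x y = begin
    (x + y) ^ p                               ≈⟨ Binomial.theorem commutativeSemiring p x y ⟩
    term 0F + sum (term ∘ Fin.suc)            ≈⟨ +-cong first (sum-init-last (term ∘ Fin.suc)) ⟩
    y ^ p + (sum (λ i → term (Fin.suc (inject₁ i))) + term (Fin.suc (fromℕ n)))
      ≈⟨ +-congˡ (+-cong (trans (sum-cong-≋ middle) (sum-replicate-zero n)) last′) ⟩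
    y ^ p + (0# + x ^ p)                      ≈⟨ +-congˡ (+-identityˡ _) ⟩
    y ^ p + x ^ p                             ≈⟨ +-comm _ _ ⟩
    x ^ p + y ^ p                             ∎
    where
    term : Vector Carrier (suc p)
    term = Binomial.binomialTerm commutativeSemiring x y p
    first : term 0F ≈ y ^ p
    first = trans (×-homo-1 _) (*-identityˡ _)
    middle : ∀ i → term (Fin.suc (inject₁ i)) ≈ 0#
    middle i = multiple≈0 p1≈0
      (prime∣binomial pr (ℕ.s≤s ℕ.z≤n)
        (ℕ.s≤s (≡.subst (ℕ._< n) (≡.sym (Fin.toℕ-inject₁ i)) (Fin.toℕ<n i)))) _
    last′ : term (Fin.suc (fromℕ n)) ≈ x ^ p
    last′ rewrite Fin.toℕ-fromℕ n | nCn≡1 p | ℕ.n∸n≡0 n = trans (×-homo-1 _) (*-identityʳ _)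

  frobenius : ∀ {p} → Prime p → p · 1# ≈ 0# → ∀ k x y →
    (x + y) ^ (p ℕ.^ k) ≈ x ^ (p ℕ.^ k) + y ^ (p ℕ.^ k)
  frobenius pr p1≈0 zero x y =
    trans (*-identityʳ _) (sym (+-cong (*-identityʳ _) (*-identityʳ _)))
  frobenius {p} pr p1≈0 (suc k) x y = begin
    (x + y) ^ (p ℕ.* p ℕ.^ k)                       ≈⟨ ^-assocʳ (x + y) p _ ⟨
    ((x + y) ^ p) ^ (p ℕ.^ k)                       ≈⟨ ^-congˡ (p ℕ.^ k) (frobenius-prime pr p1≈0 x y) ⟩
    (x ^ p + y ^ p) ^ (p ℕ.^ k)                     ≈⟨ frobenius pr p1≈0 k _ _ ⟩
    (x ^ p) ^ (p ℕ.^ k) + (y ^ p) ^ (p ℕ.^ k)       ≈⟨ +-cong (^-assocʳ x p _) (^-assocʳ y p _) ⟩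
    x ^ (p ℕ.* p ℕ.^ k) + y ^ (p ℕ.* p ℕ.^ k)       ∎

-- Arithmetic in a finite field.

module FiniteFieldProperties {c ℓ q} (F : FiniteField c ℓ q) where

  open FiniteField F
  open ≈-Reasoning setoid
  open import Algebra.Properties.Semiring.Mult semiring using (×1-homo-*; ×-homo-1)
  private module Card = Inverse cardinality

  code : Carrier → Fin q
  code = Card.to

  element : Fin q → Carrier
  element = Card.from

  element-code : ∀ x → element (code x) ≈ x
  element-code = Card.strictlyInverseʳ

  element-injective : ∀ {i j} → element i ≈ element j → i ≡ j
  element-injective {i} {j} eq =
    ≡.trans (≡.sym (Card.strictlyInverseˡ i)) (≡.trans (Card.to-cong eq) (Card.strictlyInverseˡ j))

  infix 4 _≈?_
  _≈?_ : Decidable _≈_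
  x ≈? y = map′
    (λ eq → trans (sym (element-code x)) (trans (reflexive (≡.cong element eq)) (element-code y)))
    Card.to-cong (code x Fin.≟ code y)

  inverse : ∀ {x} → ¬ x ≈ 0# → Carrier
  inverse x≉0 = proj₁ (invertible x≉0)

  inverseˡ : ∀ {x} (x≉0 : ¬ x ≈ 0#) → inverse x≉0 * x ≈ 1#
  inverseˡ x≉0 = proj₁ (proj₂ (invertible x≉0))

  inverseʳ : ∀ {x} (x≉0 : ¬ x ≈ 0#) → x * inverse x≉0 ≈ 1#
  inverseʳ x≉0 = proj₂ (proj₂ (invertible x≉0))

  cancelˡ : ∀ {x y z} → ¬ x ≈ 0# → x * y ≈ x * z → y ≈ z
  cancelˡ {x} {y} {z} x≉0 xy≈xz = begin
    y                       ≈⟨ strip y ⟨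
    inverse x≉0 * (x * y)   ≈⟨ *-congˡ xy≈xz ⟩
    inverse x≉0 * (x * z)   ≈⟨ strip z ⟩
    z                       ∎
    where
    strip : ∀ w → inverse x≉0 * (x * w) ≈ w
    strip w = trans (sym (*-assoc _ _ _)) (trans (*-congʳ (inverseˡ x≉0)) (*-identityˡ w))

  cancel-inverse : ∀ {x} (x≉0 : ¬ x ≈ 0#) y → x * (inverse x≉0 * y) ≈ y
  cancel-inverse x≉0 y = trans (sym (*-assoc _ _ _)) (trans (*-congʳ (inverseʳ x≉0)) (*-identityˡ y))

  -- The quotient y/x, delivered as an index because the normal forms are parametrised by `Fin q`.
  fraction : ∀ {x} → ¬ x ≈ 0# → ∀ y → ∃ λ i → x * element i ≈ y
  fraction x≉0 y = code (inverse x≉0 * y) ,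
    trans (*-congˡ (element-code _)) (cancel-inverse x≉0 y)

  zeroProduct : ∀ {x y} → ¬ x ≈ 0# → x * y ≈ 0# → y ≈ 0#
  zeroProduct x≉0 xy≈0 = cancelˡ x≉0 (trans xy≈0 (sym (zeroʳ _)))

  integral : ∀ {x y} → x * y ≈ 0# → x ≈ 0# ⊎ y ≈ 0#
  integral {x} xy≈0 with x ≈? 0#
  ... | yes x≈0 = inj₁ x≈0
  ... | no  x≉0 = inj₂ (zeroProduct x≉0 xy≈0)

  product≉0 : ∀ {x y} → ¬ x ≈ 0# → ¬ y ≈ 0# → ¬ x * y ≈ 0#
  product≉0 x≉0 y≉0 xy≈0 = y≉0 (zeroProduct x≉0 xy≈0)

  inverse≉0 : ∀ {x} (x≉0 : ¬ x ≈ 0#) → ¬ inverse x≉0 ≈ 0#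
  inverse≉0 x≉0 y≈0 = 1≉0 (trans (sym (inverseʳ x≉0)) (trans (*-congˡ y≈0) (zeroʳ _)))

  power≈0 : ∀ {x} n → x ^ n ≈ 0# → x ≈ 0#
  power≈0 zero    1≈0 = contradiction 1≈0 1≉0
  power≈0 (suc n) xx≈0 = [ id , power≈0 n ]′ (integral xx≈0)

  -- Adding 1 permutes the field, so the sum S of all elements satisfies S = q · 1 + S.
  cardinality-multiple : q · 1# ≈ 0#
  cardinality-multiple =
    GroupProperties.identityˡ-unique +-group _ _ (sym
      (Translation.sum-translate +-commutativeMonoid element element-injective {1#} { - 1#}
        (-‿inverseˡ 1#) (translate 1#) (translate (- 1#))))
    where
    translate : ∀ x i → ∃ λ j → element j ≈ x + element i
    translate x i = code (x + element i) , element-code _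

  -- The image of p to the power n is the n-th power of the image of p, and a field has no zero
  -- divisors.
  characteristic : ∀ {p} n → q ≡ p ℕ.^ n → p · 1# ≈ 0#
  characteristic {p} n q≡pⁿ = go n (trans (reflexive (≡.cong (_· 1#) (≡.sym q≡pⁿ))) cardinality-multiple)
    where
    go : ∀ n → (p ℕ.^ n) · 1# ≈ 0# → p · 1# ≈ 0#
    go zero    1≈0  = contradiction (trans (sym (×-homo-1 1#)) 1≈0) 1≉0
    go (suc n) pp≈0 = [ id , go n ]′ (integral (trans (sym (×1-homo-* p (p ℕ.^ n))) pp≈0))

module NonzeroElements {c ℓ m} (F : FiniteField c ℓ (suc m)) where

  open FiniteField F
  open FiniteFieldProperties F
  open ≈-Reasoning setoid

  -- `punchIn` skips the index of zero, leaving m of the m + 1 elements.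
  nonzero : Fin m → Carrier
  nonzero i = element (punchIn (code 0#) i)

  nonzero≉0 : ∀ i → ¬ nonzero i ≈ 0#
  nonzero≉0 i eq = Fin.punchInᵢ≢i (code 0#) i
    (element-injective (trans eq (sym (element-code 0#))))

  nonzero-injective : ∀ {i j} → nonzero i ≈ nonzero j → i ≡ j
  nonzero-injective eq = Fin.punchIn-injective (code 0#) _ _ (element-injective eq)

  nonzero-surjective : ∀ {x} → ¬ x ≈ 0# → ∃ λ i → nonzero i ≈ x
  nonzero-surjective {x} x≉0 = punchOut code≢ ,
    trans (reflexive (≡.cong element (Fin.punchIn-punchOut code≢))) (element-code x)
    where
    code≢ : ¬ code 0# ≡ code x
    code≢ eq = x≉0 (trans (sym (element-code x))
      (trans (reflexive (≡.cong element (≡.sym eq))) (element-code 0#)))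

  -- For nonzero x, multiplication by x permutes the m nonzero elements; their product P is nonzero
  -- and equals x to the power m times P.
  fermat : ∀ x → x ^ suc m ≈ x
  fermat x with x ≈? 0#
  ... | yes x≈0 = trans (*-congʳ x≈0) (trans (zeroˡ _) (sym x≈0))
  ... | no  x≉0 = trans (*-congˡ xᵐ≈1) (*-identityʳ x)
    where
    open CommutativeMonoidSum *-commutativeMonoid using () renaming (sum to ∏)
    translate : ∀ {y} → ¬ y ≈ 0# → ∀ i → ∃ λ j → nonzero j ≈ y * nonzero i
    translate y≉0 i = nonzero-surjective (product≉0 y≉0 (nonzero≉0 i))
    ∏≉0 : ∀ {n} (e : Vector Carrier n) → (∀ i → ¬ e i ≈ 0#) → ¬ ∏ e ≈ 0#
    ∏≉0 {zero}  e e≉0 = 1≉0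
    ∏≉0 {suc n} e e≉0 = product≉0 (e≉0 0F) (∏≉0 (e ∘ Fin.suc) (e≉0 ∘ Fin.suc))
    xᵐ≈1 : x ^ m ≈ 1#
    xᵐ≈1 = cancelˡ (∏≉0 nonzero nonzero≉0) (begin
      ∏ nonzero * x ^ m  ≈⟨ *-comm _ _ ⟩
      x ^ m * ∏ nonzero  ≈⟨ Translation.sum-translate *-commutativeMonoid nonzero nonzero-injective
                              (inverseˡ x≉0) (translate x≉0) (translate (inverse≉0 x≉0)) ⟨
      ∏ nonzero          ≈⟨ *-identityʳ _ ⟨
      ∏ nonzero * 1#     ∎)

module _ {a ℓ} (S : Setoid a ℓ) where

  open Setoid S

  -- The chosen preimages need not be assumed compatible with `≈`: injectivity of `f` forces equal
  -- elements to have the same preimage.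
  enumerate : ∀ {x n} {X : Set x} (f : X → Carrier) → (∀ {x y} → f x ≈ f y → x ≡ y) →
    (∀ s → ∃ λ x → s ≈ f x) → X ↔ Fin n → HasCardinality S n
  enumerate f f-injective f-surjective X↔Fin = record
    { to        = λ s → X.to (proj₁ (f-surjective s))
    ; from      = λ i → f (X.from i)
    ; to-cong   = λ {s} {t} s≈t → ≡.cong X.to (f-injective
        (trans (sym (proj₂ (f-surjective s))) (trans s≈t (proj₂ (f-surjective t)))))
    ; from-cong = λ { ≡.refl → refl }
    ; inverse   =
        (λ {i} {s} s≈fi → ≡.trans
          (≡.cong X.to (f-injective (trans (sym (proj₂ (f-surjective s))) s≈fi)))
          (X.strictlyInverseˡ i)) ,
        (λ { {s} ≡.refl → trans (reflexive (≡.cong f (X.strictlyInverseʳ _)))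
          (sym (proj₂ (f-surjective s))) })
    }
    where
    module X = Inverse X↔Fin

-- Proportional vectors.

module Proportionality {c ℓ q} (F : FiniteField c ℓ q) where

  open FiniteField F
  open FiniteFieldProperties F
  open Projective F
  open TernaryForms rawRing using (_⊗_; identity; substitute; substituteLinear)
  open Identities commutativeRing
  open Congruences commutativeRing
  open InverseSubstitution commutativeRing
  open ≈-Reasoning setoid

  ∼-resp-≋ : ∀ {n} {u u′ v v′ : Vector Carrier n} → u ≋ u′ → v ≋ v′ → u ∼ v → u′ ∼ v′
  ∼-resp-≋ u≋u′ v≋v′ (k , k≉0 , u≋kv) =
    k , k≉0 , λ i → trans (sym (u≋u′ i)) (trans (u≋kv i) (*-congˡ (v≋v′ i)))

  ∼-vanishes : ∀ {n} {u v : Vector Carrier n} → u ∼ v → ∀ i → v i ≈ 0# → u i ≈ 0#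
  ∼-vanishes (k , _ , u≋kv) i vᵢ≈0 = trans (u≋kv i) (trans (*-congˡ vᵢ≈0) (zeroʳ k))

  ∼-vanishes⁻ : ∀ {n} {u v : Vector Carrier n} → u ∼ v → ∀ i → u i ≈ 0# → v i ≈ 0#
  ∼-vanishes⁻ (k , k≉0 , u≋kv) i uᵢ≈0 = zeroProduct k≉0 (trans (sym (u≋kv i)) uᵢ≈0)

  ∼-normalised : ∀ {n} {u v : Vector Carrier n} i → u i ≈ 1# → v i ≈ 1# → u ∼ v → u ≋ v
  ∼-normalised {u = u} {v} i uᵢ≈1 vᵢ≈1 (k , k≉0 , u≋kv) j = begin
    u j        ≈⟨ u≋kv j ⟩
    k * v j    ≈⟨ *-congʳ k≈1 ⟩
    1# * v j   ≈⟨ *-identityˡ _ ⟩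
    v j        ∎
    where
    k≈1 : k ≈ 1#
    k≈1 = trans (sym (*-identityʳ k)) (trans (*-congˡ (sym vᵢ≈1)) (trans (sym (u≋kv i)) uᵢ≈1))

  substitute-zero : ∀ M {g} → g ≋ (λ _ → 0#) → substitute M g ≋ (λ _ → 0#)
  substitute-zero M {g} g≋0 i = begin
    substitute M g i
      ≈⟨ substitute-cong (λ _ _ → refl) (λ j → trans (g≋0 j) (sym (zeroˡ _))) i ⟩
    substitute M (scale 0# g) i    ≈⟨ substitute-scale 0# M g i ⟩
    0# * substitute M g i          ≈⟨ zeroˡ _ ⟩
    0#                             ∎

  module _ {M N} (MN≋I : ∀ i → (M ⊗ N) i ≋ identity i) where

    substitute-∼ : ∀ {a b} → substitute M a ∼ b → a ∼ substitute N b
    substitute-∼ {a} {b} (k , k≉0 , Ma≋kb) = k , k≉0 , λ i →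
      trans (sym (substitute-inverse MN≋I a i))
      (trans (substitute-cong (λ _ _ → refl) Ma≋kb i) (substitute-scale k N b i))

    substituteLinear-∼⁻ : ∀ {l m} → substituteLinear M l ∼ substituteLinear M m → l ∼ m
    substituteLinear-∼⁻ {l} {m} (k , k≉0 , Ml≋kMm) = k , k≉0 , λ i →
      trans (sym (substituteLinear-inverse MN≋I l i))
      (trans (substituteLinear-cong (λ _ _ → refl) Ml≋kMm i)
      (trans (substituteLinear-scale k N (substituteLinear M m) i)
      (*-congˡ (substituteLinear-inverse MN≋I m i))))

-- The two matrices come from separate `with` definitions, which agree by computation only after the
-- test `i ≟ j` has been decided.
identity-≡ : ∀ {c ℓ q} (F : FiniteField c ℓ q) i j →
  Matrices.identity F i j ≡ TernaryForms.identity (FiniteField.rawRing F) i j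
identity-≡ F i j with i Fin.≟ j
... | yes _ = ≡.refl
... | no  _ = ≡.refl

-- Hyperplanes through a line of the orbit.

module Orbit {c ℓ c′ ℓ′ p q} (F : FiniteField c ℓ q) (E : QuadraticExtension c′ ℓ′ F)
             (L : Pred (Projective.PG F 5) p) (L∈o₅ : L ∈ Matrices.o₅ F) where

  open import Data.Vec.Functional using (_∷_; [])
  open FiniteField F
  open FiniteFieldProperties F
  open Projective F
  open Matrices F using (o₅-representative)
  open Hyperplanes F E
  open TernaryForms rawRing hiding (scale)
  open Identities commutativeRing
  open Congruences commutativeRing
  open InverseSubstitution commutativeRing
  open Proportionality F
  open ≈-Reasoning setoid

  A B : Matrix₃ Carrier
  A = proj₁ (proj₁ L∈o₅)
  B = proj₁ (proj₂ (proj₁ L∈o₅))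

  AB≋I : ∀ i → (A ⊗ B) i ≋ identity i
  AB≋I i j = trans (proj₂ (proj₂ (proj₂ (proj₁ L∈o₅))) i j) (reflexive (identity-≡ F i j))

  BA≋I : ∀ i → (B ⊗ A) i ≋ identity i
  BA≋I i j = trans (proj₁ (proj₂ (proj₂ (proj₁ L∈o₅))) i j) (reflexive (identity-≡ F i j))

  private
    -- If all squares of the entries in column k of `A` vanished, so would the column and with it
    -- the entry (k, k) of `B ⊗ A`, which is 1. The premise is trivial for each concrete k, where
    -- the identity matrix computes.
    columnPoint : ∀ k → identity k k ≈ 1# → PG 5
    columnPoint k Iₖₖ≈1 = veronese (column A k) , λ ν≋0 →
      1≉0 (begin
        1#                          ≈⟨ Iₖₖ≈1 ⟨
        identity k k                ≈⟨ BA≋I k k ⟨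
        (B ⊗ A) k k
          ≈⟨ sum-cong-≋ (λ i → trans (*-congˡ {B k i} (square (coordinate≈0 ν≋0 i))) (zeroʳ _)) ⟩
        sum {3} (λ _ → 0#)          ≈⟨ sum-replicate-zero 3 ⟩
        0#                          ∎)
      where
      open import Algebra.Properties.Monoid.Sum +-monoid using (sum-cong-≋; sum-replicate-zero)
      square : ∀ {x} → x * x ≈ 0# → x ≈ 0#
      square xx≈0 = [ id , id ]′ (integral xx≈0)
      coordinate≈0 : veronese (column A k) ≋ (λ _ → 0#) → ∀ i → A i k * A i k ≈ 0#
      coordinate≈0 ν≋0 0F = ν≋0 0F
      coordinate≈0 ν≋0 1F = ν≋0 3F
      coordinate≈0 ν≋0 2F = ν≋0 5F

    diagonalPoint : ∀ s t → ¬ (s ≈ 0# × t ≈ 0#) → ∃ λ (Y : PG 5) → Y ∈ o₅-representative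
    diagonalPoint s t st≉0 =
      (upper (diagonal s t) , λ y≋0 → st≉0 (y≋0 0F , y≋0 3F)) ,
      ((s ∷ t ∷ [] , λ v≋0 → st≉0 (v≋0 0F , v≋0 1F)) ,
        1# , 1≉0 , λ i j →
          trans (reflexive (symmetric-diagonal s t i j)) (sym (*-identityˡ _)))

  -- Coefficients 0 and 3 after substitution are, by definition, the incidences with uuᵀ and vvᵀ, so
  -- it suffices that these two points lie on `L`.
  contains⇒ : ∀ H → Contains H L →
    substitute A (proj₁ H) 0F ≈ 0# × substitute A (proj₁ H) 3F ≈ 0#
  contains⇒ H L⊆H =
    L⊆H (columnPoint 0F refl) (Equivalence.from (proj₂ L∈o₅ _)
      (proj₁ Y₀ , proj₂ Y₀ , 1# , 1≉0 , symmetric-column₀ A)) ,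
    L⊆H (columnPoint 1F refl) (Equivalence.from (proj₂ L∈o₅ _)
      (proj₁ Y₁ , proj₂ Y₁ , 1# , 1≉0 , symmetric-column₁ A))
    where
    Y₀ = diagonalPoint 1# 0# (1≉0 ∘ proj₁)
    Y₁ = diagonalPoint 0# 1# (1≉0 ∘ proj₂)

  ⇒contains : ∀ H → substitute A (proj₁ H) 0F ≈ 0# → substitute A (proj₁ H) 3F ≈ 0# → Contains H L
  ⇒contains (a , _) g₀≈0 g₃≈0 (x , _) X∈L with Equivalence.to (proj₂ L∈o₅ _) X∈L
  ... | Y , ((v , _) , d , _ , Y≋dD) , k , _ , X≋kAYAᵀ = begin
    incidence a x
      ≈⟨ incidence-cong {a} {a} (λ _ → refl) x≋ ⟩
    incidence a (upper (map (scale k) (A ⊗ map (scale d) (diagonal (v 0F) (v 1F)) ⊗ transpose A)))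
      ≈⟨ incidence-orbit k d (v 0F) (v 1F) A a ⟩
    k * d * (v 0F * substitute A a 0F + v 1F * substitute A a 3F)
      ≈⟨ *-congˡ (+-cong (trans (*-congˡ g₀≈0) (zeroʳ _)) (trans (*-congˡ g₃≈0) (zeroʳ _))) ⟩
    k * d * (0# + 0#)
      ≈⟨ trans (*-congˡ (+-identityˡ 0#)) (zeroʳ _) ⟩
    0# ∎
    where
    upper-symmetric : x ≋ upper (symmetric x)
    upper-symmetric 0F = refl
    upper-symmetric 1F = refl
    upper-symmetric 2F = refl
    upper-symmetric 3F = refl
    upper-symmetric 4F = refl
    upper-symmetric 5F = refl
    x≋ : x ≋ upper (map (scale k) (A ⊗ map (scale d) (diagonal (v 0F) (v 1F)) ⊗ transpose A))
    x≋ i = trans (upper-symmetric i) (upper-cong (λ i j → trans (X≋kAYAᵀ i j)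
      (*-congˡ (⊗-cong {N = transpose A} {transpose A}
        (⊗-cong {A} {A} (λ _ _ → refl) Y≋dD) (λ _ _ → refl) i j))) i)

  -- Moves the count to coordinates where u and v are base points: `A` carries a hyperplane to its
  -- normal form `G x`, and `B` carries the normal form back. Each type then needs only a family of
  -- pairwise non-proportional forms that exhausts it.
  numberContaining : ∀ {r x} {X : Set x} {n} (ℋ : Pred Hyperplane r) (G : X → Vector Carrier 6) →
    (∀ x → ¬ G x ≋ (λ _ → 0#)) → (∀ x → G x 0F ≈ 0#) → (∀ x → G x 3F ≈ 0#) →
    (∀ {x y} → G x ∼ G y → x ≡ y) →
    (∀ x G≉0 → (substitute B (G x) , G≉0) ∈ ℋ) →
    (∀ H → H ∈ ℋ → let g = substitute A (proj₁ H) in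
      ¬ g ≋ (λ _ → 0#) → g 0F ≈ 0# → g 3F ≈ 0# → ∃ λ x → g ∼ G x) →
    X ↔ Fin n → NumberContaining L ℋ n
  numberContaining {X = X} ℋ G G≉0 G₀≈0 G₃≈0 G-injective G∈ℋ G-surjective = enumerate
    (subsetoid λ H → H ∈ ℋ × Contains H L) hyperplane
    (λ {x} {y} SG∼SG → G-injective (∼-resp-≋ (λ _ → refl) (ASB y) (substitute-∼ BA≋I SG∼SG)))
    (λ (H@(a , a≉0) , H∈ℋ , L⊆H) →
      let g₀≈0 , g₃≈0 = contains⇒ H L⊆H
          g≉0 g≋0     = a≉0 λ i → trans (sym (substitute-inverse AB≋I a i)) (substitute-zero B g≋0 i)
          x , AH∼G    = G-surjective H H∈ℋ g≉0 g₀≈0 g₃≈0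
      in x , substitute-∼ AB≋I AH∼G)
    where
    ASB : ∀ x → substitute A (substitute B (G x)) ≋ G x
    ASB x = substitute-inverse BA≋I (G x)
    hyperplane : X → Setoid.Carrier (subsetoid λ H → H ∈ ℋ × Contains H L)
    hyperplane x = H , G∈ℋ x (proj₂ H) ,
      ⇒contains H (trans (ASB x 0F) (G₀≈0 x)) (trans (ASB x 3F) (G₃≈0 x))
      where
      H : PG 5
      H = substitute B (G x) , λ SG≋0 → G≉0 x λ i → trans (sym (ASB x i)) (substitute-zero A SG≋0 i)

-- Singular conics through two base points.

module NormalForms {c ℓ q} (F : FiniteField c ℓ q) where

  open import Data.Vec.Functional using (_∷_; [])
  open FiniteField F
  open FiniteFieldProperties F
  open Projective F
  open TernaryForms rawRing hiding (scale)
  open Identities commutativeRing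
  open Congruences commutativeRing
  open Proportionality F
  open ≈-Reasoning setoid

  private
    zero-sum : ∀ {x y} u v → x ≈ 0# → y ≈ 0# → x * u + v * y ≈ 0#
    zero-sum u v x≈0 y≈0 = trans
      (+-cong (trans (*-congʳ x≈0) (zeroˡ u)) (trans (*-congˡ y≈0) (zeroʳ v))) (+-identityˡ 0#)

    zeroʳ′ : ∀ {x} k → x ≈ 0# → k * x ≈ 0#
    zeroʳ′ k x≈0 = trans (*-congˡ x≈0) (zeroʳ k)

  X₂ : Vector Carrier 3
  X₂ = 0# ∷ 0# ∷ 1# ∷ []

  doubleLine : Vector Carrier 6
  doubleLine = 0# ∷ 0# ∷ 0# ∷ 0# ∷ 0# ∷ 1# ∷ []

  doubleLine-square : doubleLine ≋ scale 1# (product X₂ X₂)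
  doubleLine-square 0F = solve 0 (con (+ 0) := con (+ 1) :* (con (+ 0) :* con (+ 0))) refl
  doubleLine-square 1F = solve 0 (con (+ 0) := con (+ 1) :* (con (+ 0) :* con (+ 0) :+ con (+ 0) :* con (+ 0))) refl
  doubleLine-square 2F = solve 0 (con (+ 0) := con (+ 1) :* (con (+ 0) :* con (+ 1) :+ con (+ 1) :* con (+ 0))) refl
  doubleLine-square 3F = solve 0 (con (+ 0) := con (+ 1) :* (con (+ 0) :* con (+ 0))) refl
  doubleLine-square 4F = solve 0 (con (+ 0) := con (+ 1) :* (con (+ 0) :* con (+ 1) :+ con (+ 1) :* con (+ 0))) refl
  doubleLine-square 5F = solve 0 (con (+ 1) := con (+ 1) :* (con (+ 1) :* con (+ 1))) refl

  -- The coefficients of X₀² and X₁² are k l₀² and k l₁²; they vanish while k does not, so l is a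
  -- multiple of X₂.
  doubleLine-unique : ∀ {g} k l → g ≋ scale k (product l l) → ¬ g ≋ (λ _ → 0#) →
    g 0F ≈ 0# → g 3F ≈ 0# → g ∼ doubleLine
  doubleLine-unique {g} k l g≋kl² g≉0 g₀≈0 g₃≈0 = g 5F , g₅≉0 , λ where
      0F → vanishing 0F g₀≈0
      1F → vanishing 1F g₁≈0
      2F → vanishing 2F g₂≈0
      3F → vanishing 3F g₃≈0
      4F → vanishing 4F g₄≈0
      5F → sym (*-identityʳ _)
    where
    k≉0 : ¬ k ≈ 0#
    k≉0 k≈0 = g≉0 λ i → trans (g≋kl² i) (trans (*-congʳ k≈0) (zeroˡ _))
    root : ∀ i {x} → g i ≈ k * (x * x) → g i ≈ 0# → x ≈ 0#
    root i gᵢ≈kx² gᵢ≈0 = [ id , id ]′ (integral (zeroProduct k≉0 (trans (sym gᵢ≈kx²) gᵢ≈0)))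
    l₀≈0 : l 0F ≈ 0#
    l₀≈0 = root 0F (g≋kl² 0F) g₀≈0
    l₁≈0 : l 1F ≈ 0#
    l₁≈0 = root 3F (g≋kl² 3F) g₃≈0
    g₁≈0 : g 1F ≈ 0#
    g₁≈0 = trans (g≋kl² 1F) (zeroʳ′ k (zero-sum _ _ l₀≈0 l₀≈0))
    g₂≈0 : g 2F ≈ 0#
    g₂≈0 = trans (g≋kl² 2F) (zeroʳ′ k (zero-sum _ _ l₀≈0 l₀≈0))
    g₄≈0 : g 4F ≈ 0#
    g₄≈0 = trans (g≋kl² 4F) (zeroʳ′ k (zero-sum _ _ l₁≈0 l₁≈0))
    vanishing : ∀ i → g i ≈ 0# → g i ≈ g 5F * 0#
    vanishing i gᵢ≈0 = trans gᵢ≈0 (sym (zeroʳ _))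
    g₅≉0 : ¬ g 5F ≈ 0#
    g₅≉0 g₅≈0 = g≉0 λ where
      0F → g₀≈0
      1F → g₁≈0
      2F → g₂≈0
      3F → g₃≈0
      4F → g₄≈0
      5F → g₅≈0

  -- The three summands record whether the leading coefficient, scaled to 1, stands at X₀X₁, X₀X₂ or
  -- X₁X₂.
  LinePair : Set
  LinePair = (Fin q × Fin q) ⊎ (Fin q × Fin q) ⊎ Fin q

  -- (X₀ + dX₂)(X₁ + cX₂), X₂(X₀ + dX₁ + eX₂) and X₂(X₁ + eX₂).
  linePair : LinePair → Vector Carrier 6
  linePair (inj₁ (i , j)) = 0# ∷ 1# ∷ element i ∷ 0# ∷ element j ∷ element i * element j ∷ []
  linePair (inj₂ (inj₁ (i , j))) = 0# ∷ 0# ∷ 1# ∷ 0# ∷ element i ∷ element j ∷ []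
  linePair (inj₂ (inj₂ i)) = 0# ∷ 0# ∷ 0# ∷ 0# ∷ 1# ∷ element i ∷ []

  linePair₀ : ∀ x → linePair x 0F ≈ 0#
  linePair₀ (inj₁ _)        = refl
  linePair₀ (inj₂ (inj₁ _)) = refl
  linePair₀ (inj₂ (inj₂ _)) = refl

  linePair₃ : ∀ x → linePair x 3F ≈ 0#
  linePair₃ (inj₁ _)        = refl
  linePair₃ (inj₂ (inj₁ _)) = refl
  linePair₃ (inj₂ (inj₂ _)) = refl

  linePair≉0 : ∀ x → ¬ linePair x ≋ (λ _ → 0#)
  linePair≉0 (inj₁ _)        x≋0 = 1≉0 (x≋0 1F)
  linePair≉0 (inj₂ (inj₁ _)) x≋0 = 1≉0 (x≋0 2F)
  linePair≉0 (inj₂ (inj₂ _)) x≋0 = 1≉0 (x≋0 4F)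

  linePair-injective : ∀ {x y} → linePair x ∼ linePair y → x ≡ y
  linePair-injective {inj₁ _} {inj₁ _} x∼y =
    let x≋y = ∼-normalised 1F refl refl x∼y
    in ≡.cong inj₁ (≡.cong₂ _,_ (element-injective (x≋y 2F)) (element-injective (x≋y 4F)))
  linePair-injective {inj₂ (inj₁ _)} {inj₂ (inj₁ _)} x∼y =
    let x≋y = ∼-normalised 2F refl refl x∼y
    in ≡.cong (inj₂ ∘ inj₁) (≡.cong₂ _,_ (element-injective (x≋y 4F)) (element-injective (x≋y 5F)))
  linePair-injective {inj₂ (inj₂ _)} {inj₂ (inj₂ _)} x∼y =
    ≡.cong (inj₂ ∘ inj₂) (element-injective (∼-normalised 4F refl refl x∼y 5F))
  linePair-injective {inj₁ _} {inj₂ (inj₁ _)} x∼y = contradiction (∼-vanishes x∼y 1F refl) 1≉0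
  linePair-injective {inj₁ _} {inj₂ (inj₂ _)} x∼y = contradiction (∼-vanishes x∼y 1F refl) 1≉0
  linePair-injective {inj₂ (inj₁ _)} {inj₁ _} x∼y = contradiction (∼-vanishes⁻ x∼y 1F refl) 1≉0
  linePair-injective {inj₂ (inj₂ _)} {inj₁ _} x∼y = contradiction (∼-vanishes⁻ x∼y 1F refl) 1≉0
  linePair-injective {inj₂ (inj₁ _)} {inj₂ (inj₂ _)} x∼y = contradiction (∼-vanishes x∼y 2F refl) 1≉0
  linePair-injective {inj₂ (inj₂ _)} {inj₂ (inj₁ _)} x∼y = contradiction (∼-vanishes⁻ x∼y 2F refl) 1≉0

  linePair-product : ∀ x → ∃₂ λ l m → ¬ l ∼ m × linePair x ≋ product l m
  linePair-product (inj₁ (i , j)) =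
    1# ∷ 0# ∷ element j ∷ [] , 0# ∷ 1# ∷ element i ∷ [] ,
    (λ l∼m → 1≉0 (∼-vanishes l∼m 0F refl)) , λ where
      0F → solve 0 (con (+ 0) := con (+ 1) :* con (+ 0)) refl
      1F → solve 0 (con (+ 1) := con (+ 1) :* con (+ 1) :+ con (+ 0) :* con (+ 0)) refl
      2F → solve 2 (λ c d → c := con (+ 1) :* c :+ d :* con (+ 0)) refl (element i) (element j)
      3F → solve 0 (con (+ 0) := con (+ 0) :* con (+ 1)) refl
      4F → solve 2 (λ c d → d := con (+ 0) :* c :+ d :* con (+ 1)) refl (element i) (element j)
      5F → *-comm _ _
  linePair-product (inj₂ (inj₁ (i , j))) =
    X₂ , 1# ∷ element i ∷ element j ∷ [] ,
    (λ l∼m → 1≉0 (∼-vanishes⁻ l∼m 0F refl)) , λ where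
      0F → solve 0 (con (+ 0) := con (+ 0) :* con (+ 1)) refl
      1F → solve 1 (λ d → con (+ 0) := con (+ 0) :* d :+ con (+ 0) :* con (+ 1)) refl (element i)
      2F → solve 1 (λ e → con (+ 1) := con (+ 0) :* e :+ con (+ 1) :* con (+ 1)) refl (element j)
      3F → sym (zeroˡ _)
      4F → solve 2 (λ d e → d := con (+ 0) :* e :+ con (+ 1) :* d) refl (element i) (element j)
      5F → sym (*-identityˡ _)
  linePair-product (inj₂ (inj₂ i)) =
    X₂ , 0# ∷ 1# ∷ element i ∷ [] ,
    (λ l∼m → 1≉0 (∼-vanishes⁻ l∼m 1F refl)) , λ where
      0F → sym (zeroˡ _)
      1F → solve 0 (con (+ 0) := con (+ 0) :* con (+ 1) :+ con (+ 0) :* con (+ 0)) refl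
      2F → solve 1 (λ e → con (+ 0) := con (+ 0) :* e :+ con (+ 1) :* con (+ 0)) refl (element i)
      3F → sym (zeroˡ _)
      4F → solve 1 (λ e → con (+ 1) := con (+ 0) :* e :+ con (+ 1) :* con (+ 1)) refl (element i)
      5F → sym (*-identityˡ _)

  private
    -- Since l₂m₂ is nonzero, l₀m₀ = 0 together with l₀m₂ + l₂m₀ = 0 kills both l₀ and m₀, and
    -- likewise l₁ and m₁. Both forms are multiples of X₂, with ratio l₂/m₂.
    proportional : ∀ {g l m} → g ≋ product l m → ¬ g 5F ≈ 0# →
      g 0F ≈ 0# → g 2F ≈ 0# → g 3F ≈ 0# → g 4F ≈ 0# → l ∼ m
    proportional {g} {l} {m} g≋lm g₅≉0 g₀≈0 g₂≈0 g₃≈0 g₄≈0 =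
      l 2F * inverse m₂≉0 , product≉0 l₂≉0 (inverse≉0 m₂≉0) , λ where
        0F → trans (proj₁ lm₀) (sym (zeroʳ′ _ (proj₂ lm₀)))
        1F → trans (proj₁ lm₁) (sym (zeroʳ′ _ (proj₂ lm₁)))
        2F → sym (trans (*-assoc _ _ _) (trans (*-congˡ (inverseˡ m₂≉0)) (*-identityʳ _)))
      where
      l₂≉0 : ¬ l 2F ≈ 0#
      l₂≉0 l₂≈0 = g₅≉0 (trans (g≋lm 5F) (trans (*-congʳ l₂≈0) (zeroˡ _)))
      m₂≉0 : ¬ m 2F ≈ 0#
      m₂≉0 m₂≈0 = g₅≉0 (trans (g≋lm 5F) (zeroʳ′ _ m₂≈0))
      vanish : ∀ {x y} → x * y ≈ 0# → x * m 2F + l 2F * y ≈ 0# → x ≈ 0# × y ≈ 0#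
      vanish {x} {y} xy≈0 s≈0 with integral xy≈0
      ... | inj₁ x≈0 = x≈0 , zeroProduct l₂≉0 (begin
        l 2F * y               ≈⟨ +-identityˡ _ ⟨
        0# + l 2F * y          ≈⟨ +-congʳ (trans (*-congʳ x≈0) (zeroˡ _)) ⟨
        x * m 2F + l 2F * y    ≈⟨ s≈0 ⟩
        0#                     ∎)
      ... | inj₂ y≈0 = zeroProduct m₂≉0 (begin
        m 2F * x               ≈⟨ *-comm _ _ ⟩
        x * m 2F               ≈⟨ +-identityʳ _ ⟨
        x * m 2F + 0#          ≈⟨ +-congˡ (zeroʳ′ _ y≈0) ⟨
        x * m 2F + l 2F * y    ≈⟨ s≈0 ⟩
        0#                     ∎) , y≈0
      lm₀ = vanish (trans (sym (g≋lm 0F)) g₀≈0) (trans (sym (g≋lm 2F)) g₂≈0)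
      lm₁ = vanish (trans (sym (g≋lm 3F)) g₃≈0) (trans (sym (g≋lm 4F)) g₄≈0)

  discriminant-through : ∀ g → g 0F ≈ 0# → g 3F ≈ 0# →
    discriminant g ≈ g 1F * (g 2F * g 4F - g 5F * g 1F)
  discriminant-through g g₀≈0 g₃≈0 = begin
    discriminant g  ≈⟨ discriminant-expand g ⟩
    D + (g 0F * _ - g 3F * _)
      ≈⟨ +-congˡ (+-cong (trans (*-congʳ g₀≈0) (zeroˡ _)) (-‿cong (trans (*-congʳ g₃≈0) (zeroˡ _)))) ⟩
    D + (0# - 0#)  ≈⟨ trans (+-congˡ (-‿inverseʳ 0#)) (+-identityʳ _) ⟩
    D              ∎
    where D = g 1F * (g 2F * g 4F - g 5F * g 1F)

  -- The first nonzero coefficient among those of X₀X₁, X₀X₂, X₁X₂ serves as scalar. If all three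
  -- vanish, only X₂² remains and the factors would be proportional.
  linePair-surjective : ∀ {g} l m → ¬ l ∼ m → g ≋ product l m → ¬ g ≋ (λ _ → 0#) →
    g 0F ≈ 0# → g 3F ≈ 0# → ∃ λ x → g ∼ linePair x
  linePair-surjective {g} l m l≁m g≋lm g≉0 g₀≈0 g₃≈0
    with g 1F ≈? 0# | g 2F ≈? 0# | g 4F ≈? 0#
  ... | no g₁≉0 | _ | _ =
    let i , gᵢ≈g₂ = fraction g₁≉0 (g 2F)
        j , gⱼ≈g₄ = fraction g₁≉0 (g 4F)
    in inj₁ (i , j) , g 1F , g₁≉0 , λ where
      0F → trans g₀≈0 (sym (zeroʳ _))
      1F → sym (*-identityʳ _)
      2F → sym gᵢ≈g₂
      3F → trans g₃≈0 (sym (zeroʳ _))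
      4F → sym gⱼ≈g₄
      -- The last coefficient is not free: a product has zero discriminant, hence g₅g₁ = g₂g₄.
      5F → cancelˡ g₁≉0 (begin
        g 1F * g 5F
          ≈⟨ *-comm _ _ ⟩
        g 5F * g 1F
          ≈⟨ x∙y⁻¹≈ε⇒x≈y _ _ (zeroProduct g₁≉0 D≈0) ⟨
        g 2F * g 4F
          ≈⟨ *-cong gᵢ≈g₂ gⱼ≈g₄ ⟨
        (g 1F * element i) * (g 1F * element j)
          ≈⟨ solve 3 (λ b c d → (b :* c) :* (b :* d) := b :* (b :* (c :* d))) refl (g 1F) (element i) (element j) ⟩
        g 1F * (g 1F * (element i * element j)) ∎)
    where
    open import Algebra.Properties.Group +-group using (x∙y⁻¹≈ε⇒x≈y)
    D≈0 : g 1F * (g 2F * g 4F - g 5F * g 1F) ≈ 0#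
    D≈0 = trans (sym (discriminant-through g g₀≈0 g₃≈0))
      (trans (discriminant-cong g≋lm) (discriminant-product l m))
  ... | yes g₁≈0 | no g₂≉0 | _ =
    let i , gᵢ≈g₄ = fraction g₂≉0 (g 4F)
        j , gⱼ≈g₅ = fraction g₂≉0 (g 5F)
    in inj₂ (inj₁ (i , j)) , g 2F , g₂≉0 , λ where
      0F → trans g₀≈0 (sym (zeroʳ _))
      1F → trans g₁≈0 (sym (zeroʳ _))
      2F → sym (*-identityʳ _)
      3F → trans g₃≈0 (sym (zeroʳ _))
      4F → sym gᵢ≈g₄
      5F → sym gⱼ≈g₅
  ... | yes g₁≈0 | yes g₂≈0 | no g₄≉0 =
    let i , gᵢ≈g₅ = fraction g₄≉0 (g 5F)
    in inj₂ (inj₂ i) , g 4F , g₄≉0 , λ where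
      0F → trans g₀≈0 (sym (zeroʳ _))
      1F → trans g₁≈0 (sym (zeroʳ _))
      2F → trans g₂≈0 (sym (zeroʳ _))
      3F → trans g₃≈0 (sym (zeroʳ _))
      4F → sym (*-identityʳ _)
      5F → sym gᵢ≈g₅
  ... | yes g₁≈0 | yes g₂≈0 | yes g₄≈0 =
    contradiction (proportional g≋lm g₅≉0 g₀≈0 g₂≈0 g₃≈0 g₄≈0) l≁m
    where
    g₅≉0 : ¬ g 5F ≈ 0#
    g₅≉0 g₅≈0 = g≉0 λ where
      0F → g₀≈0
      1F → g₁≈0
      2F → g₂≈0
      3F → g₃≈0
      4F → g₄≈0
      5F → g₅≈0

-- Non-singular conics through two base points.

module SmoothNormalForms {c ℓ m} (F : FiniteField c ℓ (suc m)) where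

  open import Data.Vec.Functional using (_∷_; [])
  open FiniteField F
  open FiniteFieldProperties F
  open NonzeroElements F
  open NormalForms F using (discriminant-through)
  open Projective F
  open TernaryForms rawRing hiding (scale)
  open Identities commutativeRing
  open Proportionality F
  open ≈-Reasoning setoid

  open import Algebra.Properties.Group +-group using (⁻¹-injective; ∙-cancelˡ)

  SmoothConic : Set
  SmoothConic = Fin (suc m) × Fin (suc m) × Fin m

  -- The last coefficient is parametrised so that the discriminant is exactly `nonzero k`.
  smooth : SmoothConic → Vector Carrier 6
  smooth (i , j , k) =
    0# ∷ 1# ∷ element i ∷ 0# ∷ element j ∷ element i * element j - nonzero k ∷ []

  smooth-discriminant : ∀ x → ¬ discriminant (smooth x) ≈ 0#
  smooth-discriminant (i , j , k) Δ≈0 =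
    nonzero≉0 k (trans (sym (discriminant-normalForm (element i) (element j) (nonzero k))) Δ≈0)

  smooth-injective : ∀ {x y} → smooth x ∼ smooth y → x ≡ y
  smooth-injective {i , j , k} {i′ , j′ , k′} x∼y
    with x≋y ← ∼-normalised 1F refl refl x∼y
    with ≡.refl ← element-injective {i} {i′} (x≋y 2F) | ≡.refl ← element-injective {j} {j′} (x≋y 4F)
    with ≡.refl ← nonzero-injective {k} {k′} (⁻¹-injective (∙-cancelˡ _ _ _ (x≋y 5F)))
    = ≡.refl

  smooth-surjective : ∀ {g} → ¬ discriminant g ≈ 0# → g 0F ≈ 0# → g 3F ≈ 0# →
    ∃ λ x → g ∼ smooth x
  smooth-surjective {g} Δ≉0 g₀≈0 g₃≈0 = (i , j , k) , b , b≉0 , λ where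
      0F → trans g₀≈0 (sym (zeroʳ _))
      1F → sym (*-identityʳ _)
      2F → sym (proj₂ c/b)
      3F → trans g₃≈0 (sym (zeroʳ _))
      4F → sym (proj₂ d/b)
      5F → cancelˡ b≉0 (begin
        b * g 5F
          ≈⟨ solve 4 (λ b c d e → b :* e := c :* d :- (c :* d :- e :* b)) refl b (g 2F) (g 4F) (g 5F) ⟩
        g 2F * g 4F - D
          ≈⟨ +-cong (*-cong (proj₂ c/b) (proj₂ d/b)) (-‿cong b²k≈D) ⟨
        (b * element i) * (b * element j) - b * (b * nonzero k)
          ≈⟨ solve 4 (λ b c d e → (b :* c) :* (b :* d) :- b :* (b :* e) := b :* (b :* (c :* d :- e)))
               refl b (element i) (element j) (nonzero k) ⟩
        b * (b * (element i * element j - nonzero k)) ∎)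
    where
    b = g 1F
    D = g 2F * g 4F - g 5F * g 1F
    Δ≈bD : discriminant g ≈ b * D
    Δ≈bD = discriminant-through g g₀≈0 g₃≈0
    b≉0 : ¬ b ≈ 0#
    b≉0 b≈0 = Δ≉0 (trans Δ≈bD (trans (*-congʳ b≈0) (zeroˡ _)))
    D≉0 : ¬ D ≈ 0#
    D≉0 D≈0 = Δ≉0 (trans Δ≈bD (trans (*-congˡ D≈0) (zeroʳ _)))
    c/b = fraction b≉0 (g 2F)
    d/b = fraction b≉0 (g 4F)
    -- After division of g by b, the discriminant of the normalised form is (c/b)(d/b) - e/b = D/b².
    D/b² = nonzero-surjective (product≉0 (inverse≉0 b≉0) (product≉0 (inverse≉0 b≉0) D≉0))
    i = proj₁ c/b
    j = proj₁ d/b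
    k = proj₁ D/b²
    b²k≈D : b * (b * nonzero k) ≈ D
    b²k≈D = trans (*-congˡ (trans (*-congˡ (proj₂ D/b²)) (cancel-inverse b≉0 _)))
      (cancel-inverse b≉0 D)

-- Conjugate line pairs over the quadratic extension.

module Imaginary {c ℓ c′ ℓ′ m} (F : FiniteField c ℓ (suc m)) (E : QuadraticExtension c′ ℓ′ F)
                 (isPrimePower : IsPrimePower (suc m)) where

  private
    module F  = FiniteField F
    module TF = TernaryForms F.rawRing
    module PF = Projective F
    q = suc m

  open QuadraticExtension E
  open IsRingHomomorphism isRingHomomorphism
  open FiniteFieldProperties field²
  open Projective field² using (_∼_; _≋_; scale)
  open TernaryForms rawRing hiding (scale)
  open Identities commutativeRing
  open Congruences commutativeRing
  open InverseSubstitution commutativeRing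
  open import Algebra.Properties.CommutativeSemiring.Exp commutativeSemiring using (^-distrib-*; ^-congˡ)
  open ≈-Reasoning setoid

  embed-sum : ∀ {n} (u : Vector F.Carrier n) → embed (F.sum u) ≈ sum (map embed u)
  embed-sum {zero}  u = 0#-homo
  embed-sum {suc n} u = trans (+-homo _ _) (+-congˡ (embed-sum (u ∘ Fin.suc)))

  embed-^ : ∀ x n → embed (x F.^ n) ≈ embed x ^ n
  embed-^ x zero    = 1#-homo
  embed-^ x (suc n) = trans (*-homo _ _) (*-congˡ (embed-^ x n))

  embed-incidence : ∀ a y → embed (TF.incidence a y) ≈ incidence (map embed a) (map embed y)
  embed-incidence a y = trans (embed-sum λ i → a i F.* y i)
    (sum-cong-≋ λ i → *-homo (a i) (y i))
    where open import Algebra.Properties.Monoid.Sum +-monoid using (sum-cong-≋)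

  embed-value : ∀ a x → embed (TF.value a x) ≈ value (map embed a) (map embed x)
  embed-value a x = trans (embed-incidence a (TF.veronese x))
    (incidence-cong {map embed a} (λ _ → refl) embed-veronese)
    where
    embed-veronese : map embed (TF.veronese x) ≋ veronese (map embed x)
    embed-veronese 0F = *-homo _ _
    embed-veronese 1F = *-homo _ _
    embed-veronese 2F = *-homo _ _
    embed-veronese 3F = *-homo _ _
    embed-veronese 4F = *-homo _ _
    embed-veronese 5F = *-homo _ _

  embed-⊗ : ∀ M N i → map embed ((M TF.⊗ N) i) ≋ (map (map embed) M ⊗ map (map embed) N) i
  embed-⊗ M N i j = trans (embed-sum λ k → M i k F.* N k j)
    (sum-cong-≋ λ k → *-homo (M i k) (N k j))
    where open import Algebra.Properties.Monoid.Sum +-monoid using (sum-cong-≋)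

  embed-identity : ∀ i → map embed (TF.identity i) ≋ identity i
  embed-identity i j with i Fin.≟ j
  ... | yes _ = 1#-homo
  ... | no  _ = 0#-homo

  embed≈0 : ∀ {x} → embed x ≈ 0# → x F.≈ F.0#
  embed≈0 {x} ex≈0 with FiniteFieldProperties._≈?_ F x F.0#
  ... | yes x≈0 = x≈0
  ... | no  x≉0 = contradiction (begin
    1#                                ≈⟨ 1#-homo ⟨
    embed F.1#                        ≈⟨ ⟦⟧-cong (proj₂ (proj₂ (F.invertible x≉0))) ⟨
    embed (x F.* _)                   ≈⟨ *-homo _ _ ⟩
    embed x * embed _                 ≈⟨ trans (*-congʳ ex≈0) (zeroˡ _) ⟩
    0#                                ∎) 1≉0

  conjugate-embed : ∀ x → conjugate (embed x) ≈ embed x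
  conjugate-embed x = trans (sym (embed-^ x q)) (⟦⟧-cong (NonzeroElements.fermat F x))

  conjugate-* : ∀ x y → conjugate (x * y) ≈ conjugate x * conjugate y
  conjugate-* x y = ^-distrib-* x y q

  conjugate-+ : ∀ x y → conjugate (x + y) ≈ conjugate x + conjugate y
  conjugate-+ x y = let p , k , p-prime , q≡p^k = isPrimePower in
    ≡.subst (λ n → (x + y) ^ n ≈ x ^ n + y ^ n) (≡.sym q≡p^k)
      (Characteristic.frobenius commutativeRing p-prime
        -- The extension has q² elements, a power of the same prime p, so it too has characteristic
        -- p.
        (characteristic {p} (suc k ℕ.* 2) (≡.trans (≡.cong (ℕ._^ 2) q≡p^k) (ℕ.^-*-assoc p (suc k) 2)))
        (suc k) x y)

  conjugate-eval : ∀ l x → conjugate (eval l (map embed x)) ≈ eval (map conjugate l) (map embed x)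
  conjugate-eval l x = trans (conjugate-+ _ _)
    (+-cong (trans (conjugate-+ _ _) (+-cong (term 0F) (term 1F))) (term 2F))
    where
    term : ∀ i → conjugate (l i * embed (x i)) ≈ conjugate (l i) * embed (x i)
    term i = trans (conjugate-* _ _) (*-congˡ (conjugate-embed (x i)))

  imaginary⇒proportional : ∀ (A B : Matrix₃ F.Carrier) →
    (∀ i → (A TF.⊗ B) i PF.≋ TF.identity i) →
    ∀ {a} k l → ¬ a PF.≋ (λ _ → F.0#) →
    map embed a ≋ scale (embed k) (product l (map conjugate l)) →
    TF.substitute A a 0F F.≈ F.0# → TF.substitute A a 3F F.≈ F.0# →
    l ∼ map conjugate l
  imaginary⇒proportional A B AB≋I {a} k l a≉0 a≋kll̄ g₀≈0 g₃≈0 = proportional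
    where
    A′ = map (map embed) A
    B′ = map (map embed) B
    t  = substituteLinear A′ l 2F
    k≉0 : ¬ embed k ≈ 0#
    k≉0 k≈0 = a≉0 λ i → embed≈0 (trans (a≋kll̄ i) (trans (*-congʳ k≈0) (zeroˡ _)))
    vanish : ∀ u → TF.value a u F.≈ F.0# → eval l (map embed u) ≈ 0#
    -- At a rational point the product of s = l(u) and its conjugate is s to the power q + 1, so its
    -- vanishing forces s = 0.
    vanish u f[u]≈0 = power≈0 (suc q) (zeroProduct k≉0 (begin
      embed k * (s * conjugate s)
        ≈⟨ *-congˡ (*-congˡ (conjugate-eval l u)) ⟩
      embed k * (s * eval (map conjugate l) (map embed u))
        ≈⟨ value-product (embed k) l (map conjugate l) (map embed u) ⟨
      value (scale (embed k) (product l (map conjugate l))) (map embed u)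
        ≈⟨ value-cong {x = map embed u} a≋kll̄ (λ _ → refl) ⟨
      value (map embed a) (map embed u)
        ≈⟨ embed-value a u ⟨
      embed (TF.value a u)
        ≈⟨ trans (⟦⟧-cong f[u]≈0) 0#-homo ⟩
      0# ∎))
      where s = eval l (map embed u)
    A′B′≋I : ∀ i → (A′ ⊗ B′) i ≋ identity i
    A′B′≋I i j = trans (sym (embed-⊗ A B i j)) (trans (⟦⟧-cong (AB≋I i j)) (embed-identity i j))
    -- The first two coefficients of l ∘ A are l(u) = l(v) = 0, leaving t X₂; substituting `B` back
    -- gives t times the last row of `B`.
    rational : ∀ j → l j ≈ t * embed (B 2F j)
    rational j = begin
      l j                                                    ≈⟨ substituteLinear-inverse A′B′≋I l j ⟨
      substituteLinear B′ (substituteLinear A′ l) j          ≈⟨ expand j ⟩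
      eval (substituteLinear A′ l) (column B′ j)
        ≈⟨ +-congʳ (+-cong (trans (*-congʳ (vanish (TF.column A 0F) g₀≈0)) (zeroˡ _))
                           (trans (*-congʳ (vanish (TF.column A 1F) g₃≈0)) (zeroˡ _))) ⟩
      0# + 0# + t * embed (B 2F j)                           ≈⟨ trans (+-congʳ (+-identityˡ 0#)) (+-identityˡ _) ⟩
      t * embed (B 2F j)                                     ∎
      where
      expand : ∀ j → substituteLinear B′ (substituteLinear A′ l) j ≈ eval (substituteLinear A′ l) (column B′ j)
      expand 0F = refl
      expand 1F = refl
      expand 2F = refl
    conjugate-l : ∀ j → conjugate (l j) ≈ conjugate t * embed (B 2F j)
    conjugate-l j = trans (^-congˡ q (rational j))
      (trans (conjugate-* _ _) (*-congˡ (conjugate-embed (B 2F j))))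
    proportional : l ∼ map conjugate l
    proportional with t ≈? 0#
    -- Here l = 0, and `∼` also relates the zero vector to itself.
    ... | yes t≈0 = 1# , 1≉0 , λ j → trans (l≈0 j) (sym (trans (*-identityˡ _)
                      (trans (*-congʳ (l≈0 j)) (zeroˡ _))))
      where
      l≈0 : ∀ j → l j ≈ 0#
      l≈0 j = trans (rational j) (trans (*-congʳ t≈0) (zeroˡ _))
    ... | no t≉0 = t * t̄⁻¹ , product≉0 t≉0 (inverse≉0 t̄≉0) , λ j → begin
      l j                                          ≈⟨ rational j ⟩
      t * embed (B 2F j)                           ≈⟨ *-congˡ (*-identityˡ _) ⟨
      t * (1# * embed (B 2F j))                    ≈⟨ *-congˡ (*-congʳ (inverseˡ t̄≉0)) ⟨
      t * (t̄⁻¹ * conjugate t * embed (B 2F j))     ≈⟨ *-congˡ (*-assoc _ _ _) ⟩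
      t * (t̄⁻¹ * (conjugate t * embed (B 2F j)))   ≈⟨ *-assoc _ _ _ ⟨
      t * t̄⁻¹ * (conjugate t * embed (B 2F j))     ≈⟨ *-congˡ (conjugate-l j) ⟨
      t * t̄⁻¹ * conjugate (l j)                    ∎
      where
      t̄≉0 : ¬ conjugate t ≈ 0#
      t̄≉0 = t≉0 ∘ power≈0 q
      t̄⁻¹ = inverse t̄≉0

-- Sizes of the parameter sets.

cardinality-linePair : ∀ q → ((Fin q × Fin q) ⊎ (Fin q × Fin q) ⊎ Fin q) ↔ Fin (2 ℕ.* q ℕ.^ 2 ℕ.+ q)
cardinality-linePair q = ≡.subst (λ n → ((Fin q × Fin q) ⊎ (Fin q × Fin q) ⊎ Fin q) ↔ Fin n) count
  (↔-sym Fin.+↔⊎ ↔-∘ (↔-sym Fin.*↔× ⊎-↔ (↔-sym Fin.+↔⊎ ↔-∘ (↔-sym Fin.*↔× ⊎-↔ ↔-id _))))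
  where
  open +-*-Solver
  count : q ℕ.* q ℕ.+ (q ℕ.* q ℕ.+ q) ≡ 2 ℕ.* q ℕ.^ 2 ℕ.+ q
  count = solve 1 (λ q → q :* q :+ (q :* q :+ q) := con 2 :* q :^ 2 :+ q) ≡.refl q

cardinality-smooth : ∀ m → (Fin (suc m) × Fin (suc m) × Fin m) ↔ Fin (suc m ℕ.^ 3 ℕ.∸ suc m ℕ.^ 2)
cardinality-smooth m = ≡.subst (λ n → (Fin (suc m) × Fin (suc m) × Fin m) ↔ Fin n) count
  (↔-sym Fin.*↔× ↔-∘ (↔-id _ ×-↔ ↔-sym Fin.*↔×))
  where
  open +-*-Solver
  -- The additive form of the equation comes first, so that the truncated subtraction cancels
  -- exactly.
  cube : suc m ℕ.^ 3 ≡ suc m ℕ.^ 2 ℕ.+ suc m ℕ.* (suc m ℕ.* m)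
  cube = solve 1 (λ m →
    (con 1 :+ m) :^ 3 := (con 1 :+ m) :^ 2 :+ (con 1 :+ m) :* ((con 1 :+ m) :* m)) ≡.refl m
  count : suc m ℕ.* (suc m ℕ.* m) ≡ suc m ℕ.^ 3 ℕ.∸ suc m ℕ.^ 2
  count = ≡.sym (≡.trans (≡.cong (ℕ._∸ suc m ℕ.^ 2) cube) (ℕ.m+n∸m≡n (suc m ℕ.^ 2) _))

-- The four counts.

module HyperplaneOrbits {c ℓ c′ ℓ′ p m} (F : FiniteField c ℓ (suc m)) (E : QuadraticExtension c′ ℓ′ F)
    (L : Pred (Projective.PG F 5) p) (L∈o₅ : L ∈ Matrices.o₅ F) where

  open FiniteField F
  open FiniteFieldProperties F
  open Projective F
  open Hyperplanes F E
  open TernaryForms rawRing hiding (scale)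
  open Identities commutativeRing
  open Congruences commutativeRing
  open InverseSubstitution commutativeRing
  open Proportionality F
  open Orbit F E L L∈o₅
  open NormalForms F
  open SmoothNormalForms F

  doubleLines : NumberContaining L ℋ₁ 1
  doubleLines = numberContaining {X = Fin 1} ℋ₁ (λ _ → doubleLine)
    (λ _ x≋0 → 1≉0 (x≋0 5F)) (λ _ → refl) (λ _ → refl) (λ { {0F} {0F} _ → ≡.refl })
    (λ _ _ → 1# , substituteLinear B X₂ , substitute-square B 1# X₂ doubleLine-square)
    (λ (H , _) (k , l , H≋kl²) g≉0 g₀≈0 g₃≈0 →
      0F , doubleLine-unique k (substituteLinear A l) (substitute-square A k l H≋kl²) g≉0 g₀≈0 g₃≈0)
    (↔-id _)
    where
    substitute-square : ∀ M k l {a} → a ≋ scale k (product l l) →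
      substitute M a ≋ scale k (product (substituteLinear M l) (substituteLinear M l))
    substitute-square M k l a≋kl² i = trans (substitute-cong {M} {M} (λ _ _ → refl) a≋kl² i)
      (trans (substitute-scale k M (product l l) i) (*-congˡ (substitute-product M l l i)))

  realLinePairs : NumberContaining L ℋ₂ᵣ (2 ℕ.* suc m ℕ.^ 2 ℕ.+ suc m)
  realLinePairs = numberContaining ℋ₂ᵣ linePair
      linePair≉0 linePair₀ linePair₃ linePair-injective
    (λ x _ → substitute-ℋ₂ᵣ {B} {A} BA≋I (linePair-product x))
    (λ (H , _) H∈ℋ g≉0 g₀≈0 g₃≈0 →
      let l , m , l≁m , g≋lm = substitute-ℋ₂ᵣ {A} {B} AB≋I H∈ℋ
      in linePair-surjective l m l≁m g≋lm g≉0 g₀≈0 g₃≈0)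
    (cardinality-linePair (suc m))
    where
    substitute-ℋ₂ᵣ : ∀ {M N} → (∀ i → (M ⊗ N) i ≋ identity i) → ∀ {a} →
      (∃₂ λ l m → ¬ l ∼ m × a ≋ product l m) →
      ∃₂ λ l m → ¬ l ∼ m × substitute M a ≋ product l m
    substitute-ℋ₂ᵣ {M} {N} MN≋I (l , m , l≁m , a≋lm) =
      substituteLinear M l , substituteLinear M m ,
      l≁m ∘ substituteLinear-∼⁻ {M} {N} MN≋I , λ i →
      trans (substitute-cong {M} {M} (λ _ _ → refl) a≋lm i) (substitute-product M l m i)

  imaginaryLinePairs : IsPrimePower (suc m) → NumberContaining L ℋ₂ᵢ 0
  imaginaryLinePairs isPrimePower = numberContaining {X = Fin 0} ℋ₂ᵢ
      (λ ()) (λ ()) (λ ()) (λ ()) (λ { {()} }) (λ ())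
    (λ (H , H≉0) (k , l , l≁l̄ , H≋kll̄) _ g₀≈0 g₃≈0 → contradiction
      (Imaginary.imaginary⇒proportional F E isPrimePower A B AB≋I k l H≉0 H≋kll̄ g₀≈0 g₃≈0) l≁l̄)
    (↔-id _)

  smoothConics : NumberContaining L ℋ₃ (suc m ℕ.^ 3 ℕ.∸ suc m ℕ.^ 2)
  smoothConics = numberContaining ℋ₃ smooth
      (λ _ x≋0 → 1≉0 (x≋0 1F)) (λ _ → refl) (λ _ → refl) smooth-injective
    (λ x _ → smooth-discriminant x ∘ discriminant-substitute⁻ {B} {A} BA≋I (smooth x))
    (λ (H , _) Δ≉0 _ → smooth-surjective (Δ≉0 ∘ discriminant-substitute⁻ {A} {B} AB≋I H))
    (cardinality-smooth m)

open import Data.Nat.Base using (_+_; _*_; _∸_; _^_)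
open import Data.Vec.Base using (_∷_; [])

lemma4p2 : {c ℓ c′ ℓ′ p : Level} (q : ℕ) → IsPrimePower q →
    (F : FiniteField c ℓ q) (E : QuadraticExtension c′ ℓ′ F) →
    (L : Pred (Projective.PG F 5) p) →
    Projective.IsLine F L →
    L ∈ Matrices.o₅ F →
    Hyperplanes.OD₄ F E L (1 ∷ 2 * q ^ 2 + q ∷ 0 ∷ q ^ 3 ∸ q ^ 2 ∷ [])
-- The zero of the field would have an index in `Fin 0`.
lemma4p2 zero _ F = contradiction (FiniteFieldProperties.code F (FiniteField.0# F)) λ ()
lemma4p2 (suc m) isPrimePower F E L _ L∈o₅ =
  doubleLines , realLinePairs , imaginaryLinePairs isPrimePower , smoothConics
  where open HyperplaneOrbits F E L L∈o₅
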